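{- Let $P$ and $Q$ be finite posets such that $P$ is both $d$-decomposable and $c$-decomposable and $Q$ is $d$-decomposable. Then the maximum size of a semiantichain in $P\times Q$ equals the minimum size of a unichain covering of $P\times Q$, and this common value is $$\sum_{i=1}^{\min(h(P),h(Q))}\mu_i^P\mu_i^Q=\sum_{j=1}^{w(P)} d_{\lambda_j^P}(Q).$$
   Context: All posets are finite. $h(P)$ and $w(P)$ denote the height (size of a largest chain) and width (size of a largest antichain) of $P$. The product $P\times Q$ is ordered by $(u,x)\le(v,y)$ iff $u\le_P v$ and $x\le_Q y$. A unichain in $P\times Q$ is a chain of the form $\{p\}\times C'$ ($C'$ a chain of $Q$) or $C\times\{q\}$ ($C$ a chain of $P$); a unichain covering is a family of unichains whose union is $P\times Q$. A semiantichain is a set $S\subseteq P\times Q$ such that no two distinct elements of $S$ lie in a common unichain. A $k$-antichain (resp. $k$-chain) is a union of $k$ antichains (resp. $k$ disjoint chains); $d_k(P)$ (resp. $c_k(P)$) is the maximum size of a $k$-antichain (resp. $k$-chain) of $P$, with $d_0=c_0=0$. Set $\mu_k^P=d_k(P)-d_{k-1}(P)$ and $\lambda_k^P=c_k(P)-c_{k-1}(P)$ (by Greene's theorem, $\lambda^P$ is a partition of $|P|$ with conjugate partition $\mu^P$). $P$ is $d$-decomposable if it has a partition into antichains $A_1,\dots,A_{h(P)}$ with $|A_1\cup\dots\cup A_k|=d_k(P)$ for every $k$; $P$ is $c$-decomposable if it has a partition into chains $C_1,\dots,C_{w(P)}$ with $|C_1\cup\dots\cup C_k|=c_k(P)$ for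 every $k$. -}

module Defs where

open import Level using (0ℓ)
open import Data.Nat using (ℕ; zero; suc; _+_; _*_; _∸_; _≤_; _⊓_)
open import Data.Fin using (Fin)
open import Data.Fin.Subset using (Subset; _∈_; _∩_; ⋃; ∣_∣; ⊤; ⊥)
open import Data.List using (List; length; take)
open import Data.List.Relation.Unary.All using (All)
open import Data.List.Relation.Unary.Any using (Any)
open import Data.List.Relation.Unary.AllPairs using (AllPairs)
open import Data.List.Relation.Unary.Unique.Propositional using (Unique)
import Data.List.Membership.Propositional as LM
open import Data.Product using (Σ; _×_; _,_; ∃)
open import Data.Sum using (_⊎_)
open import Relation.Nullary using (¬_)
open import Relation.Binary using (Decidable; IsPartialOrder)
open import Relation.Binary.PropositionalEquality using (_≡_; _≢_)

record FinPoset : Set₁ where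
  field
    size           : ℕ
    _≼_            : Fin size → Fin size → Set
    ≼-dec          : Decidable _≼_
    isPartialOrder : IsPartialOrder _≡_ _≼_

MaxSize : ∀ {n} → (Subset n → Set) → ℕ → Set
MaxSize {n} Pr m = (Σ (Subset n) λ S → Pr S × ∣ S ∣ ≡ m)
                 × (∀ (S : Subset n) → Pr S → ∣ S ∣ ≤ m)

Disjoint : ∀ {n} → List (Subset n) → Set
Disjoint = AllPairs (λ X Y → X ∩ Y ≡ ⊥)

module _ (P : FinPoset) where
  open FinPoset P

  IsChain : Subset size → Set
  IsChain S = ∀ x y → x ∈ S → y ∈ S → (x ≼ y) ⊎ (y ≼ x)

  IsAntichain : Subset size → Set
  IsAntichain S = ∀ x y → x ∈ S → y ∈ S → x ≼ y → x ≡ y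

  IsKAntichain : ℕ → Subset size → Set
  IsKAntichain k S = Σ (List (Subset size)) λ As →
    length As ≡ k × All IsAntichain As × S ≡ ⋃ As

  IsKChain : ℕ → Subset size → Set
  IsKChain k S = Σ (List (Subset size)) λ Cs →
    length Cs ≡ k × All IsChain Cs × Disjoint Cs × S ≡ ⋃ Cs

  IsHeight : ℕ → Set
  IsHeight = MaxSize IsChain

  IsWidth : ℕ → Set
  IsWidth = MaxSize IsAntichain

  IsDFun : (ℕ → ℕ) → Set
  IsDFun d = ∀ k → MaxSize (IsKAntichain k) (d k)

  IsCFun : (ℕ → ℕ) → Set
  IsCFun c = ∀ k → MaxSize (IsKChain k) (c k)

  DDecomposable : Set
  DDecomposable = Σ ℕ λ h → IsHeight h × Σ (List (Subset size)) λ As →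
    length As ≡ h × All IsAntichain As × Disjoint As × ⋃ As ≡ ⊤ ×
    (∀ k → k ≤ h → MaxSize (IsKAntichain k) ∣ ⋃ (take k As) ∣)

  CDecomposable : Set
  CDecomposable = Σ ℕ λ w → IsWidth w × Σ (List (Subset size)) λ Cs →
    length Cs ≡ w × All IsChain Cs × Disjoint Cs × ⋃ Cs ≡ ⊤ ×
    (∀ k → k ≤ w → MaxSize (IsKChain k) ∣ ⋃ (take k Cs) ∣)

module _ (P Q : FinPoset) where
  open FinPoset P renaming (size to nP; _≼_ to _≼P_)
  open FinPoset Q renaming (size to nQ; _≼_ to _≼Q_)

  Elem : Set
  Elem = Fin nP × Fin nQ

  data Unichain : Set where
    fixP : (p : Fin nP) (C' : Subset nQ) → IsChain Q C' → Unichain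
    fixQ : (C : Subset nP) → IsChain P C → (q : Fin nQ) → Unichain

  _∈U_ : Elem → Unichain → Set
  (u , x) ∈U fixP p C' _ = u ≡ p × x ∈ C'
  (u , x) ∈U fixQ C _ q  = u ∈ C × x ≡ q

  -- subsets of P × Q are duplicate-free lists; size = length
  IsSemiantichain : List Elem → Set
  IsSemiantichain S = Unique S × (∀ s t → s LM.∈ S → t LM.∈ S → s ≢ t →
                       ∀ (U : Unichain) → ¬ (s ∈U U × t ∈U U))

  IsUnichainCovering : List Unichain → Set
  IsUnichainCovering F = ∀ (z : Elem) → Any (z ∈U_) F

  MaxSemiantichain : ℕ → Set
  MaxSemiantichain m = (Σ (List Elem) λ S → IsSemiantichain S × length S ≡ m)
                     × (∀ S → IsSemiantichain S → length S ≤ m)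

  MinUnichainCovering : ℕ → Set
  MinUnichainCovering m = (Σ (List Unichain) λ F → IsUnichainCovering F × length F ≡ m)
                        × (∀ F → IsUnichainCovering F → m ≤ length F)

sum1to : ℕ → (ℕ → ℕ) → ℕ
sum1to zero    f = 0
sum1to (suc n) f = sum1to n f + f (suc n)

-- μ_k = d_k − d_{k−1}, λ_k = c_k − c_{k−1}  (k ≥ 1)
diff : (ℕ → ℕ) → ℕ → ℕ
diff d zero    = 0
diff d (suc k) = d (suc k) ∸ d k

{-# OPTIONS --safe #-}

-- With antichain partitions A_i of P and B_i of Q realising d, the union of the
-- A_i × B_i is a semiantichain of size Σ μ_i^P μ_i^Q.  With a chain partition C_j
-- of P realising c, each C_j × Q is covered by d_{|C_j|}(Q) unichains obtained
-- from a |C_j|-saturated chain partition of Q.  Distinct elements of a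
-- semiantichain need distinct unichains, so it remains to see that the two sums
-- agree, which is Greene's conjugacy of λ^P and μ^P.
--
-- Both saturated partitions and conjugacy come from the Greene–Kleitman theorem,
-- obtained here as an assignment problem: an optimal dual solution (Egerváry,
-- via Hall) gives the k-antichain, a matching of tight edges gives the chains.

module Submission where

open import Defs
open import Data.Bool using (true; false; if_then_else_)
open import Data.Empty using () renaming (⊥ to Empty)
open import Data.Fin using (Fin; zero; suc; _≟_; splitAt; join; punchIn; punchOut; _↑ˡ_; _↑ʳ_)
open import Data.Fin.Induction using (po-noetherian)
open import Data.Fin.Properties using (any?; 0≢1+n; suc-injective; punchIn-punchOut; punchOut-injective; splitAt-join; join-splitAt; injective⇒≤; <⇒notInjective)
open import Data.Fin.Subset using (Subset; _∈_; _∉_; _⊆_; _∩_; _∪_; _─_; _-_; ∁; ⁅_⁆; ∣_∣; ⋃; ⊥; ⊤)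
open import Data.Fin.Subset.Properties
open import Data.List using (List; []; _∷_; _++_; length; map; take; drop; upTo; zipWith; cartesianProduct)
import Data.List as List
open import Data.List.Membership.Propositional.Properties using (∈-map⁺; ∈-map⁻; ∈-upTo⁺; ∈-++⁻; ∈-lookup; ∈-cartesianProduct⁻)
import Data.List.Membership.Propositional as LM
open import Data.List.Properties using (length-map; length-++; length-upTo; take-map; take++drop≡id; take-all)
open import Data.List.Relation.Unary.All as All using (All; []; _∷_)
import Data.List.Relation.Unary.All.Properties as All
open import Data.List.Relation.Unary.AllPairs using ([]; _∷_)
import Data.List.Relation.Unary.AllPairs.Properties as AllPairs
open import Data.List.Relation.Unary.Any as Any using (Any; here; there)
import Data.List.Relation.Unary.Any.Properties as Any
open import Data.List.Relation.Unary.Unique.Propositional using (Unique)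
import Data.List.Relation.Unary.Unique.Propositional.Properties as Unique
open import Data.Nat using (ℕ; zero; suc; _+_; _*_; _∸_; _⊓_; _≤_; _<_; _≤?_; z≤n; s≤s)
import Data.Nat as ℕ
open import Data.Nat.Induction using (<-wellFounded)
open import Data.Nat.ListAction using () renaming (sum to sumᴸ)
open import Data.Nat.ListAction.Properties using (sum-++)
open import Data.Nat.Properties hiding (_≟_; 0≢1+n; suc-injective)
open import Data.Nat.Tactic.RingSolver using (solve-∀)
open import Data.Product using (Σ; ∃; _×_; _,_; proj₁; proj₂)
open import Data.Product.Properties using (≡-dec)
open import Data.Sum using (_⊎_; inj₁; inj₂)
open import Data.Sum.Properties using (inj₁-injective; inj₂-injective)
open import Data.Unit using () renaming (⊤ to Unit)
open import Data.Vec using ([]; _∷_; here; there; lookup; tabulate)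
open import Data.Vec.Properties using ([]=⇒lookup; lookup⇒[]=; lookup∘tabulate)
open import Function using (_∘_; Injective)
open import Induction.WellFounded using (Acc; acc)
open import Relation.Binary using (IsPartialOrder)
open import Relation.Binary.Construct.Closure.ReflexiveTransitive using (Star; ε; _◅_; fold)
open import Relation.Binary.PropositionalEquality using (_≡_; _≢_; refl; sym; trans; cong; cong₂; subst; module ≡-Reasoning)
open import Relation.Nullary using (Dec; yes; no; does; ¬_; ¬?; contradiction)
open import Relation.Nullary.Decidable using (_×-dec_; dec-true; dec-false; decidable-stable)
open import Relation.Unary using (Decidable)

open import Algebra.Properties.CommutativeMonoid.Sum +-0-commutativeMonoid using (sum; sum-remove; sum-cong-≗; ∑-distrib-+)
open import Algebra.Properties.CommutativeSemigroup +-commutativeSemigroup using (interchange; xy∙z≈xz∙y)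
open import Algebra.Properties.Semiring.Sum +-*-semiring using (*-distribʳ-sum)

-- Subsets and sums over Fin

-- The obstacle is that a saturated partition is obtained for one `k` at a time. On the side of Q
-- this does no harm: every chain C_j of P gets its own partition of Q, with `k` = |C_j|. On the
-- side of P a single chain partition has to serve all `k`, because the sizes |C_j| must be
-- conjugate to μ^P; this is where c-decomposability enters. The assignment problem prices a chain
-- partition: `k` for a chain, 1 for an element left to the rest. An element carries two potentials,
-- `u` as a tail of edges and `v` as a head, with `v` ≤ `u` + 1. The dual objective counts at most
-- the elements where `v` = `u` + 1, and the value of `u` grades these into antichains. That exactly
-- `k` grades suffice does not follow from optimality of the costs alone; it is forced by auxiliary
-- nodes, one more of them than there are elements.

comprehension : ∀ {n} {A : Fin n → Set} → Decidable A → Subset n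
comprehension A? = tabulate (λ x → does (A? x))

module _ {n} {A : Fin n → Set} (A? : Decidable A) where

  ∈-comprehension⁺ : ∀ {x} → A x → x ∈ comprehension A?
  ∈-comprehension⁺ {x} a =
    lookup⇒[]= x _ (trans (lookup∘tabulate _ x) (dec-true (A? x) a))

  ∈-comprehension⁻ : ∀ {x} → x ∈ comprehension A? → A x
  ∈-comprehension⁻ {x} x∈ with A? x | trans (sym (lookup∘tabulate (λ y → does (A? y)) x)) ([]=⇒lookup x∈)
  ... | yes a | _ = a

∣p∪q∣+∣p∩q∣≡∣p∣+∣q∣ : ∀ {n} (p q : Subset n) → ∣ p ∪ q ∣ + ∣ p ∩ q ∣ ≡ ∣ p ∣ + ∣ q ∣
∣p∪q∣+∣p∩q∣≡∣p∣+∣q∣ []          []          = refl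
∣p∪q∣+∣p∩q∣≡∣p∣+∣q∣ (true  ∷ p) (true  ∷ q) =
  cong suc (trans (+-suc _ _) (trans (cong suc (∣p∪q∣+∣p∩q∣≡∣p∣+∣q∣ p q)) (sym (+-suc _ _))))
∣p∪q∣+∣p∩q∣≡∣p∣+∣q∣ (true  ∷ p) (false ∷ q) = cong suc (∣p∪q∣+∣p∩q∣≡∣p∣+∣q∣ p q)
∣p∪q∣+∣p∩q∣≡∣p∣+∣q∣ (false ∷ p) (true  ∷ q) =
  trans (cong suc (∣p∪q∣+∣p∩q∣≡∣p∣+∣q∣ p q)) (sym (+-suc _ _))
∣p∪q∣+∣p∩q∣≡∣p∣+∣q∣ (false ∷ p) (false ∷ q) = ∣p∪q∣+∣p∩q∣≡∣p∣+∣q∣ p q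

∣p∪q∣≤∣p∣+∣q∣ : ∀ {n} (p q : Subset n) → ∣ p ∪ q ∣ ≤ ∣ p ∣ + ∣ q ∣
∣p∪q∣≤∣p∣+∣q∣ p q = ≤-trans (m≤m+n _ _) (≤-reflexive (∣p∪q∣+∣p∩q∣≡∣p∣+∣q∣ p q))

x∈p-y⁺ : ∀ {n} {x y : Fin n} {p} → x ∈ p → x ≢ y → x ∈ p - y
x∈p-y⁺ {y = y} x∈p x≢y = x∈p∧x∉q⇒x∈p─q x∈p (x≢y ∘ x∈⁅y⁆⇒x≡y y)

x∈p─q⇒x∉q : ∀ {n} (p q : Subset n) {x} → x ∈ p ─ q → x ∉ q
x∈p─q⇒x∉q (_ ∷ p) (true ∷ q) ()         here
x∈p─q⇒x∉q (_ ∷ p) (_ ∷ q)    (there x∈) (there x∈q) = x∈p─q⇒x∉q p q x∈ x∈q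

x∈p-y⁻ : ∀ {n} {x y : Fin n} (p : Subset n) → x ∈ p - y → x ∈ p × x ≢ y
x∈p-y⁻ {y = y} p x∈ = p─q⊆p p ⁅ y ⁆ x∈ , λ { refl → x∈p─q⇒x∉q p ⁅ y ⁆ x∈ (x∈⁅x⁆ y) }

∣p∣≤1+∣p-x∣ : ∀ {n} (p : Subset n) x → ∣ p ∣ ≤ suc ∣ p - x ∣
∣p∣≤1+∣p-x∣ p x = begin
  ∣ p ∣                ≤⟨ p⊆q⇒∣p∣≤∣q∣ p⊆ ⟩
  ∣ ⁅ x ⁆ ∪ (p - x) ∣  ≤⟨ ∣p∪q∣≤∣p∣+∣q∣ ⁅ x ⁆ (p - x) ⟩
  ∣ ⁅ x ⁆ ∣ + ∣ p - x ∣  ≡⟨ cong (_+ ∣ p - x ∣) (∣⁅x⁆∣≡1 x) ⟩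
  suc ∣ p - x ∣        ∎
  where
  open ≤-Reasoning
  p⊆ : p ⊆ ⁅ x ⁆ ∪ (p - x)
  p⊆ {y} y∈p with y ≟ x
  ... | yes refl = x∈p∪q⁺ (inj₁ (x∈⁅x⁆ x))
  ... | no y≢x   = x∈p∪q⁺ (inj₂ (x∈p-y⁺ y∈p y≢x))

sum-mono-≤ : ∀ {n} {f g : Fin n → ℕ} → (∀ i → f i ≤ g i) → sum f ≤ sum g
sum-mono-≤ {zero}  f≤g = z≤n
sum-mono-≤ {suc n} f≤g = +-mono-≤ (f≤g zero) (sum-mono-≤ (f≤g ∘ suc))

sum-mono-< : ∀ {n} {f g : Fin n → ℕ} → (∀ i → f i ≤ g i) → ∀ i → f i < g i → sum f < sum g
sum-mono-< f≤g zero    f<g = +-mono-<-≤ f<g (sum-mono-≤ (f≤g ∘ suc))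
sum-mono-< f≤g (suc i) f<g = +-mono-≤-< (f≤g zero) (sum-mono-< (f≤g ∘ suc) i f<g)

-- Removing the value `f zero` from the codomain leaves an injection of the remaining indices, so
-- induction applies. It serves to sum `v` along a matching.
sum-injective-≤ : ∀ {m n} {f : Fin m → Fin n} → Injective _≡_ _≡_ f →
                  (g : Fin n → ℕ) → sum (g ∘ f) ≤ sum g
sum-injective-≤ {zero}          _   g = z≤n
sum-injective-≤ {suc m} {zero}  {f} _ g = contradiction (f zero) λ ()
sum-injective-≤ {suc m} {suc n} {f} inj g = begin
  g (f zero) + sum (g ∘ f ∘ suc)
    ≤⟨ +-monoʳ-≤ (g (f zero)) (sum-mono-≤ λ i → ≤-reflexive (cong g (sym (punchIn-punchOut (≢f0 i))))) ⟩
  g (f zero) + sum (g ∘ punchIn (f zero) ∘ f′)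
    ≤⟨ +-monoʳ-≤ (g (f zero)) (sum-injective-≤ f′-inj (g ∘ punchIn (f zero))) ⟩
  g (f zero) + sum (g ∘ punchIn (f zero))
    ≡⟨ sum-remove g ⟨
  sum g ∎
  where
  open ≤-Reasoning
  ≢f0 : ∀ i → f zero ≢ f (suc i)
  ≢f0 i eq = 0≢1+n (inj eq)
  f′ : Fin m → Fin n
  f′ i = punchOut (≢f0 i)
  f′-inj : Injective _≡_ _≡_ f′
  f′-inj {i} {j} eq = suc-injective (inj (punchOut-injective (≢f0 i) (≢f0 j) eq))

χ : ∀ {n} → Subset n → Fin n → ℕ
χ p i = if lookup p i then 1 else 0

χ≤1 : ∀ {n} (p : Subset n) i → χ p i ≤ 1
χ≤1 p i with lookup p i
... | true  = s≤s z≤n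
... | false = z≤n

χ-∈ : ∀ {n} {p : Subset n} {i} → i ∈ p → χ p i ≡ 1
χ-∈ i∈p rewrite []=⇒lookup i∈p = refl

χ-∉ : ∀ {n} {p : Subset n} {i} → i ∉ p → χ p i ≡ 0
χ-∉ {p = p} {i} i∉p with lookup p i in eq
... | true  = contradiction (lookup⇒[]= i p eq) i∉p
... | false = refl

sum-χ : ∀ {n} (p : Subset n) → sum (χ p) ≡ ∣ p ∣
sum-χ []          = refl
sum-χ (true  ∷ p) = cong suc (sum-χ p)
sum-χ (false ∷ p) = sum-χ p

-- Hall's theorem

Graph : ℕ → ℕ → Set
Graph m n = Fin m → Subset n

module _ {m n : ℕ} where

  adjacent? : ∀ (G : Graph m n) X y → Dec (∃ λ x → x ∈ X × y ∈ G x)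
  adjacent? G X y = any? (λ x → x ∈? X ×-dec y ∈? G x)

  nbhd : Graph m n → Subset m → Subset n
  nbhd G X = comprehension (adjacent? G X)

  ∈-nbhd⁺ : ∀ (G : Graph m n) {X x y} → x ∈ X → y ∈ G x → y ∈ nbhd G X
  ∈-nbhd⁺ G {X} x∈X y∈Gx = ∈-comprehension⁺ (adjacent? G X) (_ , x∈X , y∈Gx)

  ∈-nbhd⁻ : ∀ (G : Graph m n) {X y} → y ∈ nbhd G X → ∃ λ x → x ∈ X × y ∈ G x
  ∈-nbhd⁻ G {X} = ∈-comprehension⁻ (adjacent? G X)

  HallCondition : Graph m n → Set
  HallCondition G = ∀ X → ∣ X ∣ ≤ ∣ nbhd G X ∣

  Violator : Graph m n → Subset m → Set
  Violator G X = ∣ nbhd G X ∣ < ∣ X ∣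

  violator? : ∀ G → Dec (∃ (Violator G))
  violator? G = anySubset? (λ X → ∣ nbhd G X ∣ <? ∣ X ∣)

  deleteEdge : Graph m n → Fin m → Fin n → Graph m n
  deleteEdge G i y j with j ≟ i
  ... | yes _ = G j - y
  ... | no  _ = G j

  deleteEdge-⊆ : ∀ G i y j → deleteEdge G i y j ⊆ G j
  deleteEdge-⊆ G i y j with j ≟ i
  ... | yes _ = proj₁ ∘ x∈p-y⁻ (G j)
  ... | no  _ = λ w∈ → w∈

  deleteEdge-≢ˡ : ∀ G {i y j} → j ≢ i → G j ⊆ deleteEdge G i y j
  deleteEdge-≢ˡ G {i} {y} {j} j≢i w∈ with j ≟ i
  ... | yes j≡i = contradiction j≡i j≢i
  ... | no  _   = w∈

  deleteEdge-≢ʳ : ∀ G {i y j w} → w ≢ y → w ∈ G j → w ∈ deleteEdge G i y j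
  deleteEdge-≢ʳ G {i} {y} {j} w≢y w∈ with j ≟ i
  ... | yes _ = x∈p-y⁺ w∈ w≢y
  ... | no  _ = w∈

  edges : Graph m n → ℕ
  edges G = sum (λ i → ∣ G i ∣)

  deleteEdge-edges : ∀ G {i y} → y ∈ G i → edges (deleteEdge G i y) < edges G
  deleteEdge-edges G {i} {y} y∈ =
    sum-mono-< (λ j → p⊆q⇒∣p∣≤∣q∣ (deleteEdge-⊆ G i y j)) i shrinks
    where
    shrinks : ∣ deleteEdge G i y i ∣ < ∣ G i ∣
    shrinks with i ≟ i
    ... | yes _  = x∈p⇒∣p-x∣<∣p∣ y∈
    ... | no i≢i = contradiction refl i≢i

  -- Deleting an edge at `i` changes no neighbourhood of a set that avoids `i`, so such a set would
  -- already violate Hall's condition in `G`.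
  violator-∋ : ∀ {G i y X} → HallCondition G → Violator (deleteEdge G i y) X → i ∈ X
  violator-∋ {G} {i} {y} {X} hall viol with i ∈? X
  ... | yes i∈X = i∈X
  ... | no  i∉X = contradiction (hall X) (<⇒≱ (≤-<-trans (p⊆q⇒∣p∣≤∣q∣ nbhd⊆) viol))
    where
    nbhd⊆ : nbhd G X ⊆ nbhd (deleteEdge G i y) X
    nbhd⊆ w∈ with ∈-nbhd⁻ G w∈
    ... | x , x∈X , w∈Gx = ∈-nbhd⁺ (deleteEdge G i y) x∈X
      (deleteEdge-≢ˡ G (λ x≡i → i∉X (subst (_∈ X) x≡i x∈X)) w∈Gx)

  -- Rado's submodularity argument: two violators X and Y for the deletion of
  -- different edges at i would make X ∪ Y or (X ∩ Y) ∖ {i} a violator of G.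
  deletable : ∀ {G i y z X Y} → HallCondition G → y ≢ z → y ∈ G i → z ∈ G i →
              Violator (deleteEdge G i y) X → ¬ Violator (deleteEdge G i z) Y
  deletable {G} {i} {y} {z} {X} {Y} hall y≢z y∈ z∈ violX violY = <-irrefl refl (begin-strict
    ∣ X ∣ + ∣ Y ∣                  ≡⟨ ∣p∪q∣+∣p∩q∣≡∣p∣+∣q∣ X Y ⟨
    ∣ X ∪ Y ∣ + ∣ X ∩ Y ∣          ≤⟨ +-mono-≤ (hall (X ∪ Y)) (∣p∣≤1+∣p-x∣ (X ∩ Y) i) ⟩
    ∣ nbhd G (X ∪ Y) ∣ + suc ∣ (X ∩ Y) - i ∣
      ≤⟨ +-mono-≤ (p⊆q⇒∣p∣≤∣q∣ union) (s≤s (≤-trans (hall ((X ∩ Y) - i)) (p⊆q⇒∣p∣≤∣q∣ intersection))) ⟩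
    ∣ A ∪ B ∣ + suc ∣ A ∩ B ∣      ≡⟨ +-suc _ _ ⟩
    suc (∣ A ∪ B ∣ + ∣ A ∩ B ∣)    ≡⟨ cong suc (∣p∪q∣+∣p∩q∣≡∣p∣+∣q∣ A B) ⟩
    -- Two violators give two units of slack: one pays for the removal of `i`, the other makes the
    -- inequality strict.
    suc ∣ A ∣ + ∣ B ∣              <⟨ +-mono-≤-< violX violY ⟩
    ∣ X ∣ + ∣ Y ∣                  ∎)
    where
    open ≤-Reasoning
    Gy = deleteEdge G i y
    Gz = deleteEdge G i z
    A = nbhd Gy X
    B = nbhd Gz Y
    i∈X = violator-∋ hall violX
    i∈Y = violator-∋ hall violY
    -- At `i` the graph `Gy` lacks only `y` and `Gz` only `z`; since these differ, together they
    -- still reach all of `G i`.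
    at-i : ∀ {w} → w ∈ G i → w ∈ A ∪ B
    at-i {w} w∈ with w ≟ y
    ... | yes refl = x∈p∪q⁺ (inj₂ (∈-nbhd⁺ Gz i∈Y (deleteEdge-≢ʳ G y≢z y∈)))
    ... | no  w≢y  = x∈p∪q⁺ (inj₁ (∈-nbhd⁺ Gy i∈X (deleteEdge-≢ʳ G w≢y w∈)))
    union : nbhd G (X ∪ Y) ⊆ A ∪ B
    union w∈ with ∈-nbhd⁻ G w∈
    ... | x , x∈ , w∈Gx with x ≟ i
    ...   | yes refl = at-i w∈Gx
    ...   | no  x≢i with x∈p∪q⁻ X Y x∈
    ...     | inj₁ x∈X = x∈p∪q⁺ (inj₁ (∈-nbhd⁺ Gy x∈X (deleteEdge-≢ˡ G x≢i w∈Gx)))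
    ...     | inj₂ x∈Y = x∈p∪q⁺ (inj₂ (∈-nbhd⁺ Gz x∈Y (deleteEdge-≢ˡ G x≢i w∈Gx)))
    intersection : nbhd G ((X ∩ Y) - i) ⊆ A ∩ B
    intersection w∈ with ∈-nbhd⁻ G w∈
    ... | x , x∈ , w∈Gx with x∈p-y⁻ (X ∩ Y) x∈
    ...   | x∈X∩Y , x≢i with x∈p∩q⁻ X Y x∈X∩Y
    ...     | x∈X , x∈Y = x∈p∩q⁺
      ( ∈-nbhd⁺ Gy x∈X (deleteEdge-≢ˡ G x≢i w∈Gx)
      , ∈-nbhd⁺ Gz x∈Y (deleteEdge-≢ˡ G x≢i w∈Gx))

  Matching : Graph m n → Set
  Matching G = Σ (Fin m → Fin n) λ f → (∀ i → f i ∈ G i) × Injective _≡_ _≡_ f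

  matching-⊆ : ∀ {G H} → (∀ i → H i ⊆ G i) → Matching H → Matching G
  matching-⊆ H⊆G (f , f∈ , inj) = f , (λ i → H⊆G i (f∈ i)) , inj

  -- Hall's condition on singletons gives each vertex its neighbour; on pairs it forbids two
  -- vertices from sharing one.
  hall-functional : ∀ {G} → HallCondition G →
                    (∀ {i y z} → y ∈ G i → z ∈ G i → y ≡ z) → Matching G
  hall-functional {G} hall unique = f , f∈ , λ {i} {j} → inj i j
    where
    neighbour : ∀ i → ∃ λ y → y ∈ G i
    neighbour i with nonempty? (G i)
    ... | yes ne = ne
    ... | no ¬ne = contradiction (hall ⁅ i ⁆) (<⇒≱ (subst (∣ nbhd G ⁅ i ⁆ ∣ <_) (sym (∣⁅x⁆∣≡1 i))
                     (s≤s (≤-reflexive (trans (cong ∣_∣ (Empty-unique empty)) (∣⊥∣≡0 n))))))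
      where
      empty : ¬ ∃ λ y → y ∈ nbhd G ⁅ i ⁆
      empty (y , y∈) with ∈-nbhd⁻ G y∈
      ... | x , x∈ , y∈Gx = ¬ne (y , subst (λ x → y ∈ G x) (x∈⁅y⁆⇒x≡y i x∈) y∈Gx)
    f : Fin m → Fin n
    f i = proj₁ (neighbour i)
    f∈ : ∀ i → f i ∈ G i
    f∈ i = proj₂ (neighbour i)
    inj : ∀ i j → f i ≡ f j → i ≡ j
    inj i j eq with i ≟ j
    ... | yes i≡j = i≡j
    ... | no  i≢j = contradiction (begin
        2                              ≡⟨ cong₂ _+_ (∣⁅x⁆∣≡1 i) (∣⁅x⁆∣≡1 j) ⟨
        ∣ ⁅ i ⁆ ∣ + ∣ ⁅ j ⁆ ∣            ≡⟨ ∣p∪q∣+∣p∩q∣≡∣p∣+∣q∣ ⁅ i ⁆ ⁅ j ⁆ ⟨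
        ∣ ⁅ i ⁆ ∪ ⁅ j ⁆ ∣ + ∣ ⁅ i ⁆ ∩ ⁅ j ⁆ ∣
          ≡⟨ cong (∣ ⁅ i ⁆ ∪ ⁅ j ⁆ ∣ +_) (trans (cong ∣_∣ (Empty-unique disjoint)) (∣⊥∣≡0 m)) ⟩
        ∣ ⁅ i ⁆ ∪ ⁅ j ⁆ ∣ + 0            ≡⟨ +-identityʳ _ ⟩
        ∣ ⁅ i ⁆ ∪ ⁅ j ⁆ ∣                ≤⟨ hall _ ⟩
        ∣ nbhd G (⁅ i ⁆ ∪ ⁅ j ⁆) ∣       ≤⟨ p⊆q⇒∣p∣≤∣q∣ small ⟩
        ∣ ⁅ f i ⁆ ∣                     ≡⟨ ∣⁅x⁆∣≡1 (f i) ⟩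
        1                              ∎) (λ { (s≤s ()) })
      where
      open ≤-Reasoning
      disjoint : ¬ ∃ λ x → x ∈ ⁅ i ⁆ ∩ ⁅ j ⁆
      disjoint (x , x∈) with x∈p∩q⁻ ⁅ i ⁆ ⁅ j ⁆ x∈
      ... | x∈i , x∈j = i≢j (trans (sym (x∈⁅y⁆⇒x≡y i x∈i)) (x∈⁅y⁆⇒x≡y j x∈j))
      small : nbhd G (⁅ i ⁆ ∪ ⁅ j ⁆) ⊆ ⁅ f i ⁆
      small {w} w∈ with ∈-nbhd⁻ G w∈
      ... | x , x∈ , w∈Gx with x∈p∪q⁻ ⁅ i ⁆ ⁅ j ⁆ x∈
      ...   | inj₁ x∈i = subst (_∈ ⁅ f i ⁆)
                (unique (f∈ i) (subst (λ x → w ∈ G x) (x∈⁅y⁆⇒x≡y i x∈i) w∈Gx)) (x∈⁅x⁆ (f i))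
      ...   | inj₂ x∈j = subst (_∈ ⁅ f i ⁆)
                (trans eq (unique (f∈ j) (subst (λ x → w ∈ G x) (x∈⁅y⁆⇒x≡y j x∈j) w∈Gx))) (x∈⁅x⁆ (f i))

  -- As long as some vertex has two neighbours, one of the two edges can be deleted without losing
  -- Hall's condition. The number of edges decreases until the graph is functional.
  hall : ∀ G → HallCondition G → Acc _<_ (edges G) → Matching G
  hall G cond (acc rec)
    with any? (λ i → any? (λ y → any? (λ z → ¬? (y ≟ z) ×-dec y ∈? G i ×-dec z ∈? G i)))
  ... | no ¬branch = hall-functional cond (λ {i} {y} {z} → unique i y z)
    where
    unique : ∀ i y z → y ∈ G i → z ∈ G i → y ≡ z
    unique i y z y∈ z∈ with y ≟ z
    ... | yes y≡z = y≡z
    ... | no  y≢z = contradiction (i , y , z , y≢z , y∈ , z∈) ¬branch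
  ... | yes (i , y , z , y≢z , y∈ , z∈)
    with violator? (deleteEdge G i y) | violator? (deleteEdge G i z)
  ...   | no ¬v | _ = matching-⊆ (deleteEdge-⊆ G i y)
            (hall _ (λ X → ≮⇒≥ (λ v → ¬v (X , v))) (rec (deleteEdge-edges G y∈)))
  ...   | yes _ | no ¬v = matching-⊆ (deleteEdge-⊆ G i z)
            (hall _ (λ X → ≮⇒≥ (λ v → ¬v (X , v))) (rec (deleteEdge-edges G z∈)))
  ...   | yes (_ , v) | yes (_ , v′) = contradiction v′ (deletable cond y≢z y∈ z∈ v)

  matching-or-violator : ∀ G → Matching G ⊎ ∃ (Violator G)
  matching-or-violator G with violator? G
  ... | yes v = inj₂ v
  ... | no ¬v = inj₁ (hall G (λ X → ≮⇒≥ (λ v → ¬v (X , v))) (<-wellFounded _))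

-- Egerváry's theorem

module Assignment {N : ℕ} (E : Fin N → Fin N → Set) (E? : ∀ i j → Dec (E i j))
                  (c : Fin N → Fin N → ℕ) where

  -- The constraints dual to a perfect matching of least cost, with objective `sum v - sum u`. With
  -- this sign of `u` both potentials can start at 0 and only grow, so natural numbers suffice.
  Feasible : (u v : Fin N → ℕ) → Set
  Feasible u v = ∀ i j → E i j → v j ≤ u i + c i j

  Tight : (u v : Fin N → ℕ) → Fin N → Fin N → Set
  Tight u v i j = E i j × v j ≡ u i + c i j

  tight? : ∀ u v i j → Dec (Tight u v i j)
  tight? u v i j = E? i j ×-dec (v j ℕ.≟ u i + c i j)

  -- Optimality is expressed by complementary slackness, a feasible pair of potentials with a
  -- matching of tight edges, rather than as a minimum.
  record Optimum : Set where
    field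
      u v       : Fin N → ℕ
      feasible  : Feasible u v
      f         : Fin N → Fin N
      f-inj     : Injective _≡_ _≡_ f
      f-tight   : ∀ i → Tight u v i (f i)

  tightGraph : (u v : Fin N → ℕ) → Graph N N
  tightGraph u v i = comprehension (tight? u v i)

  -- The Hungarian step lowers `u` on `X` and `v` on its neighbourhood by 1. Feasibility sees only
  -- differences, so raising both on the complements has the same effect without subtraction.
  raise : (Fin N → ℕ) → Subset N → Fin N → ℕ
  raise u X i = u i + χ (∁ X) i

  -- The only critical edges go from `X` to outside its tight neighbourhood, where `v` rises and `u`
  -- does not. They are not tight, so they have a unit to spare.
  raise-feasible : ∀ {u v X} → Feasible u v →
                   Feasible (raise u X) (raise v (nbhd (tightGraph u v) X))
  raise-feasible {u} {v} {X} feas i j e with i ∈? X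
  ... | no i∉X = begin
      v j + χ (∁ Y) j      ≤⟨ +-mono-≤ (feas i j e) (χ≤1 (∁ Y) j) ⟩
      u i + c i j + 1      ≡⟨ +-assoc (u i) (c i j) 1 ⟩
      u i + (c i j + 1)    ≡⟨ cong (u i +_) (+-comm (c i j) 1) ⟩
      u i + (1 + c i j)    ≡⟨ +-assoc (u i) 1 (c i j) ⟨
      u i + 1 + c i j      ≡⟨ cong (λ t → u i + t + c i j) (χ-∈ (x∉p⇒x∈∁p i∉X)) ⟨
      u i + χ (∁ X) i + c i j ∎
    where
    open ≤-Reasoning
    Y = nbhd (tightGraph u v) X
  ... | yes i∈X = ≤-trans bound (+-monoˡ-≤ (c i j) (m≤m+n (u i) _))
    where
    open ≤-Reasoning
    Y = nbhd (tightGraph u v) X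
    bound : v j + χ (∁ Y) j ≤ u i + c i j
    bound with j ∈? Y
    ... | yes j∈Y = begin
      v j + χ (∁ Y) j  ≡⟨ cong (v j +_) (χ-∉ (x∈p⇒x∉∁p j∈Y)) ⟩
      v j + 0          ≡⟨ +-identityʳ _ ⟩
      v j              ≤⟨ feas i j e ⟩
      u i + c i j      ∎
    ... | no  j∉Y = begin
      v j + χ (∁ Y) j  ≤⟨ +-monoʳ-≤ (v j) (χ≤1 (∁ Y) j) ⟩
      v j + 1          ≡⟨ +-comm (v j) 1 ⟩
      suc (v j)        ≤⟨ ≤∧≢⇒< (feas i j e) (λ tight → j∉Y (∈-nbhd⁺ (tightGraph u v) i∈X
                            (∈-comprehension⁺ (tight? u v i) (e , tight)))) ⟩
      u i + c i j      ∎

  -- Raising u off a violator X and v off its neighbourhood closes the gap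
  -- between sum v and its upper bound sum u + sum (c i i).
  module _ (E-refl : ∀ i → E i i) where

    private
      C = sum (λ i → c i i)

    improve : ∀ gap u v → Feasible u v → sum u + C < sum v + gap → Optimum
    -- The identity is a perfect matching of cost `C`, so weak duality rules out an exhausted gap.
    improve zero u v feas lt = contradiction
      (begin
        sum v + 0                ≡⟨ +-identityʳ _ ⟩
        sum v                    ≤⟨ sum-mono-≤ (λ i → feas i i (E-refl i)) ⟩
        sum (λ i → u i + c i i)  ≡⟨ ∑-distrib-+ u (λ i → c i i) ⟩
        sum u + C                ∎)
      (<⇒≱ lt)
      where open ≤-Reasoning
    improve (suc gap) u v feas lt with matching-or-violator (tightGraph u v)
    ... | inj₁ (f , f∈ , inj) = record
      { feasible = feas ; f-inj = inj ; f-tight = λ i → ∈-comprehension⁻ (tight? u v i) (f∈ i) }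
    ... | inj₂ (X , viol) = improve gap (raise u X) (raise v Y) (raise-feasible feas) (begin
      suc (sum (raise u X) + C)            ≡⟨ cong (λ t → suc (t + C)) (sum-raise u X) ⟩
      suc (sum u + ∣ ∁ X ∣ + C)            ≡⟨ cong suc (xy∙z≈xz∙y (sum u) ∣ ∁ X ∣ C) ⟩
      suc (sum u + C) + ∣ ∁ X ∣            ≤⟨ +-monoˡ-≤ ∣ ∁ X ∣ lt ⟩
      sum v + suc gap + ∣ ∁ X ∣            ≡⟨ rearrange (sum v) gap ∣ ∁ X ∣ ⟩
      sum v + suc ∣ ∁ X ∣ + gap            ≤⟨ +-monoˡ-≤ gap (+-monoʳ-≤ (sum v) complement) ⟩
      sum v + ∣ ∁ Y ∣ + gap                ≡⟨ cong (_+ gap) (sum-raise v Y) ⟨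
      sum (raise v Y) + gap                ∎)
      where
      open ≤-Reasoning
      Y = nbhd (tightGraph u v) X
      sum-raise : ∀ w Z → sum (raise w Z) ≡ sum w + ∣ ∁ Z ∣
      sum-raise w Z = trans (∑-distrib-+ w (χ (∁ Z))) (cong (sum w +_) (sum-χ (∁ Z)))
      complement : ∣ ∁ X ∣ < ∣ ∁ Y ∣
      complement rewrite ∣∁p∣≡n∸∣p∣ X | ∣∁p∣≡n∸∣p∣ Y = ∸-monoʳ-< viol (∣p∣≤n X)
      rearrange : ∀ a b d → a + suc b + d ≡ a + suc d + b
      rearrange = solve-∀

    egerváry : Optimum
    -- For zero potentials any gap above `C` would do. The sum of zeros does not compute for a
    -- variable `N`, so it is carried along.
    egerváry = improve (suc (sum {N} (λ _ → 0) + C)) (λ _ → 0) (λ _ → 0) (λ _ _ _ → z≤n)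
                 (m≤n+m _ (sum {N} (λ _ → 0)))

-- Subsets as lists of their elements

elements : ∀ {n} → Subset n → List (Fin n)
elements []          = []
elements (true  ∷ p) = zero ∷ map suc (elements p)
elements (false ∷ p) = map suc (elements p)

length-elements : ∀ {n} (p : Subset n) → length (elements p) ≡ ∣ p ∣
length-elements []          = refl
length-elements (true  ∷ p) = cong suc (trans (length-map suc (elements p)) (length-elements p))
length-elements (false ∷ p) = trans (length-map suc (elements p)) (length-elements p)

∈-elements⁺ : ∀ {n} {p : Subset n} {x} → x ∈ p → x LM.∈ elements p
∈-elements⁺ {p = true  ∷ p} here       = here refl
∈-elements⁺ {p = true  ∷ p} (there x∈) = there (∈-map⁺ suc (∈-elements⁺ x∈))
∈-elements⁺ {p = false ∷ p} (there x∈) = ∈-map⁺ suc (∈-elements⁺ x∈)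

∈-elements⁻ : ∀ {n} (p : Subset n) {x} → x LM.∈ elements p → x ∈ p
∈-elements⁻ (true  ∷ p) (here refl) = here
∈-elements⁻ (true  ∷ p) (there x∈) with ∈-map⁻ suc x∈
... | _ , y∈ , refl = there (∈-elements⁻ p y∈)
∈-elements⁻ (false ∷ p) x∈ with ∈-map⁻ suc x∈
... | _ , y∈ , refl = there (∈-elements⁻ p y∈)

elements-unique : ∀ {n} (p : Subset n) → Unique (elements p)
elements-unique []          = []
elements-unique (true  ∷ p) =
  All.map⁺ (All.universal (λ _ ()) (elements p)) ∷ Unique.map⁺ suc-injective (elements-unique p)
elements-unique (false ∷ p) = Unique.map⁺ suc-injective (elements-unique p)

∈-⋃⁺ : ∀ {n} {ps : List (Subset n)} {x} → Any (x ∈_) ps → x ∈ ⋃ ps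
∈-⋃⁺ (here x∈p)  = x∈p∪q⁺ (inj₁ x∈p)
∈-⋃⁺ (there x∈p) = x∈p∪q⁺ (inj₂ (∈-⋃⁺ x∈p))

∈-⋃⁻ : ∀ {n} (ps : List (Subset n)) {x} → x ∈ ⋃ ps → Any (x ∈_) ps
∈-⋃⁻ []       x∈ = contradiction x∈ ∉⊥
∈-⋃⁻ (p ∷ ps) x∈ with x∈p∪q⁻ p (⋃ ps) x∈
... | inj₁ x∈p = here x∈p
... | inj₂ x∈⋃ = there (∈-⋃⁻ ps x∈⋃)

sum-split : ∀ m {n} (g : Fin (m + n) → ℕ) → sum g ≡ sum (g ∘ (_↑ˡ n)) + sum (g ∘ (m ↑ʳ_))
sum-split zero    g = refl
sum-split (suc m) g = trans (cong (g zero +_) (sum-split m (g ∘ suc))) (sym (+-assoc (g zero) _ _))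

-- The Greene–Kleitman theorem

-- A chain meets a k-antichain in at most `k` elements, so the reverse of `saturated` always holds
-- and the field amounts to equality. An element of `rest` acts as a one-element chain that is
-- charged 1 instead of `k`.
record SaturatedPartition (Q : FinPoset) (k : ℕ) : Set where
  open FinPoset Q
  field
    family       : Subset size
    isKAntichain : IsKAntichain Q k family
    chains       : List (Subset size)
    areChains    : All (IsChain Q) chains
    rest         : Subset size
    covers       : ∀ x → x ∈ rest ⊎ Any (x ∈_) chains
    saturated    : length chains * k + ∣ rest ∣ ≤ ∣ family ∣

module Network (Q : FinPoset) (k : ℕ) where
  open FinPoset Q renaming (size to n)
  open IsPartialOrder isPartialOrder using ()
    renaming (refl to ≼-refl)

  -- Matching inj₁ x to inj₁ y makes y the successor of x in its chain, or puts
  -- x into the rest if y ≡ x; matching x to some inj₂ t ends a chain.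
  Node : Set
  Node = Fin n ⊎ Fin (suc n)

  Edge : Node → Node → Set
  Edge (inj₁ x) (inj₁ y) = x ≼ y
  Edge _        _        = Unit

  edge? : ∀ a b → Dec (Edge a b)
  edge? (inj₁ x) (inj₁ y) = ≼-dec x y
  edge? (inj₁ x) (inj₂ t) = yes _
  edge? (inj₂ t) b        = yes _

  edge-refl : ∀ a → Edge a a
  edge-refl (inj₁ x) = ≼-refl
  edge-refl (inj₂ t) = _

  -- The total cost is the left side of `saturated`: a loop at `x` pays 1 for a rest element, an
  -- exit to some `inj₂ t` pays `k` for a completed chain, and passing to a proper successor is
  -- free.
  cost : Node → Node → ℕ
  cost (inj₁ x) (inj₁ y) = if does (x ≟ y) then 1 else 0
  cost (inj₁ x) (inj₂ t) = k
  cost (inj₂ t) b        = 0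

  open Assignment {n + suc n}
    (λ i j → Edge (splitAt n i) (splitAt n j)) (λ i j → edge? (splitAt n i) (splitAt n j))
    (λ i j → cost (splitAt n i) (splitAt n j)) public

  optimum : Optimum
  optimum = egerváry (λ i → edge-refl (splitAt n i))

-- From optimal potentials and a tight matching to a saturated partition

module SaturatedFromOptimum (Q : FinPoset) (k : ℕ) (opt : Network.Optimum Q k) where
  open FinPoset Q renaming (size to n)
  open IsPartialOrder isPartialOrder using ()
    renaming (refl to ≼-refl; trans to ≼-trans)
  open Network Q k using (Node; Edge; cost; module Optimum)
  open Optimum opt renaming (f to fᴺ; u to uᴺ; v to vᴺ)

  private
    split : Fin (n + suc n) → Node
    split = splitAt n

    unsplit : Node → Fin (n + suc n)
    unsplit = join n (suc n)

  u v : Node → ℕ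
  u a = uᴺ (unsplit a)
  v a = vᴺ (unsplit a)

  f : Node → Node
  f a = split (fᴺ (unsplit a))

  split-unsplit : ∀ a → split (unsplit a) ≡ a
  split-unsplit = splitAt-join n (suc n)

  f-injective : Injective _≡_ _≡_ f
  f-injective {a} {b} eq = trans (sym (split-unsplit a)) (trans (cong split
    (f-inj (trans (sym (join-splitAt n (suc n) _)) (trans (cong unsplit eq) (join-splitAt n (suc n) _)))))
    (split-unsplit b))

  dual-feasible : ∀ a b → Edge a b → v b ≤ u a + cost a b
  dual-feasible a b e with feasible (unsplit a) (unsplit b)
  ... | feas rewrite split-unsplit a | split-unsplit b = feas e

  f-edge : ∀ a → Edge a (f a)
  f-edge a with proj₁ (f-tight (unsplit a))
  ... | e rewrite split-unsplit a = e

  f-equality : ∀ a → v (f a) ≡ u a + cost a (f a)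
  f-equality a with proj₂ (f-tight (unsplit a))
  ... | eq rewrite split-unsplit a = trans (cong vᴺ (join-splitAt n (suc n) _)) eq

  sumV : (Node → ℕ) → ℕ
  sumV g = sum (λ x → g (inj₁ x))

  sumT : (Node → ℕ) → ℕ
  sumT g = sum (λ t → g (inj₂ t))

  -- The tight equalities are summed over all nodes; since the matching is injective, each `v` is
  -- counted at most once. The costs at the nodes `inj₂ t` are 0 and are dropped.
  duality : sumV u + sumT u + sumV (λ a → cost a (f a)) ≤ sumV v + sumT v
  duality = begin
    sumV u + sumT u + sumV (λ a → cost a (f a))
      ≤⟨ +-monoʳ-≤ (sumV u + sumT u) (m≤m+n _ (sumT (λ a → cost a (f a)))) ⟩
    sumV u + sumT u + (sumV (λ a → cost a (f a)) + sumT (λ a → cost a (f a)))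
      ≡⟨ interchange (sumV u) _ _ _ ⟩
    (sumV u + sumV (λ a → cost a (f a))) + (sumT u + sumT (λ a → cost a (f a)))
      ≡⟨ cong₂ _+_ (∑-distrib-+ (λ x → u (inj₁ x)) (λ x → cost (inj₁ x) (f (inj₁ x))))
                   (∑-distrib-+ (λ t → u (inj₂ t)) (λ t → cost (inj₂ t) (f (inj₂ t)))) ⟨
    sumV (λ a → u a + cost a (f a)) + sumT (λ a → u a + cost a (f a))
      ≡⟨ cong₂ _+_ (sum-cong-≗ (λ x → tight (inj₁ x))) (sum-cong-≗ (λ t → tight (inj₂ t))) ⟨
    sumV (λ a → vᴺ (fᴺ (unsplit a))) + sumT (λ a → vᴺ (fᴺ (unsplit a)))
      ≡⟨ sum-split n (vᴺ ∘ fᴺ) ⟨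
    sum (vᴺ ∘ fᴺ)
      ≤⟨ sum-injective-≤ f-inj vᴺ ⟩
    sum vᴺ
      ≡⟨ sum-split n vᴺ ⟩
    sumV v + sumT v ∎
    where
    open ≤-Reasoning
    tight : ∀ a → vᴺ (fᴺ (unsplit a)) ≡ u a + cost a (f a)
    tight a = trans (cong vᴺ (sym (join-splitAt n (suc n) _))) (f-equality a)

  -- The loop at `x` has cost 1, so `v` exceeds `u` by at most 1 there. The elements attaining this
  -- are the future k-antichain.
  Jump : Fin n → Set
  Jump x = v (inj₁ x) ≡ suc (u (inj₁ x))

  jump? : ∀ x → Dec (Jump x)
  jump? x = v (inj₁ x) ℕ.≟ suc (u (inj₁ x))

  jumps : Subset n
  jumps = comprehension jump?

  Rest : Fin n → Set
  Rest x = f (inj₁ x) ≡ inj₁ x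

  rest? : ∀ x → Dec (Rest x)
  rest? x with f (inj₁ x)
  ... | inj₂ _ = no λ ()
  ... | inj₁ y with y ≟ x
  ...   | yes refl = yes refl
  ...   | no  y≢x  = no (y≢x ∘ inj₁-injective)

  InT : Node → Set
  InT a = ∃ λ t → a ≡ inj₂ t

  inT? : ∀ a → Dec (InT a)
  inT? (inj₁ _) = no λ ()
  inT? (inj₂ t) = yes (t , refl)

  End : Fin n → Set
  End x = InT (f (inj₁ x))

  end? : ∀ x → Dec (End x)
  end? x = inT? (f (inj₁ x))

  rests ends : Subset n
  rests = comprehension rest?
  ends  = comprehension end?

  cost-f : ∀ x → χ rests x + χ ends x * k ≤ cost (inj₁ x) (f (inj₁ x))
  cost-f x = by-image (f (inj₁ x)) refl
    where
    by-image : ∀ b → f (inj₁ x) ≡ b → χ rests x + χ ends x * k ≤ cost (inj₁ x) b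
    by-image (inj₂ t) eq
      rewrite χ-∉ {p = rests} {x} (λ x∈ → contradiction (trans (sym eq) (∈-comprehension⁻ rest? x∈)) λ ())
            | χ-∈ {p = ends} {x} (∈-comprehension⁺ end? (t , eq)) = ≤-reflexive (+-identityʳ k)
    by-image (inj₁ y) eq
      rewrite χ-∉ {p = ends} {x} (λ x∈ → contradiction (trans (sym eq) (proj₂ (∈-comprehension⁻ end? x∈))) λ ())
      with x ≟ y
    ... | yes refl = subst (_≤ 1) (sym (+-identityʳ _)) (χ≤1 rests x)
    ... | no  x≢y rewrite χ-∉ {p = rests} {x}
            (λ x∈ → x≢y (inj₁-injective (trans (sym (∈-comprehension⁻ rest? x∈)) eq))) = z≤n

  v≤u+jump : ∀ x → v (inj₁ x) ≤ u (inj₁ x) + χ jumps x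
  v≤u+jump x with jump? x
  ... | yes j rewrite χ-∈ {p = jumps} (∈-comprehension⁺ jump? j) =
    ≤-reflexive (trans j (+-comm 1 _))
  ... | no ¬j = ≤-trans (≤-pred (≤∧≢⇒< v≤ ¬j)) (m≤m+n _ _)
    where
    cost≤1 : cost (inj₁ x) (inj₁ x) ≤ 1
    cost≤1 with does (x ≟ x)
    ... | true  = ≤-refl
    ... | false = z≤n
    v≤ : v (inj₁ x) ≤ suc (u (inj₁ x))
    v≤ = ≤-trans (dual-feasible _ _ ≼-refl) (≤-trans (+-monoʳ-≤ _ cost≤1) (≤-reflexive (+-comm _ 1)))

  -- The cost of the matching is at most `sum v - sum u`. The free loops at `inj₂ t` make the
  -- auxiliary nodes contribute nothing positive to it, and each element contributes at most its
  -- jump.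
  size-bound : ∣ ends ∣ * k + ∣ rests ∣ ≤ ∣ jumps ∣
  size-bound = +-cancelˡ-≤ (sumV u + sumT u) _ _ (begin
    sumV u + sumT u + (∣ ends ∣ * k + ∣ rests ∣)
      ≡⟨ cong (sumV u + sumT u +_) (begin-equality
           ∣ ends ∣ * k + ∣ rests ∣                       ≡⟨ +-comm (∣ ends ∣ * k) _ ⟩
           ∣ rests ∣ + ∣ ends ∣ * k                       ≡⟨ cong₂ _+_ (sum-χ rests) (cong (_* k) (sum-χ ends)) ⟨
           sum (χ rests) + sum (χ ends) * k              ≡⟨ cong (sum (χ rests) +_) (*-distribʳ-sum k (χ ends)) ⟩
           sum (χ rests) + sum (λ x → χ ends x * k)      ≡⟨ ∑-distrib-+ (χ rests) (λ x → χ ends x * k) ⟨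
           sum (λ x → χ rests x + χ ends x * k)          ∎) ⟩
    sumV u + sumT u + sum (λ x → χ rests x + χ ends x * k)
      ≤⟨ +-monoʳ-≤ (sumV u + sumT u) (sum-mono-≤ cost-f) ⟩
    sumV u + sumT u + sumV (λ a → cost a (f a))
      ≤⟨ duality ⟩
    sumV v + sumT v
      ≤⟨ +-mono-≤ (sum-mono-≤ v≤u+jump)
           (sum-mono-≤ (λ t → ≤-trans (dual-feasible (inj₂ t) (inj₂ t) _) (≤-reflexive (+-identityʳ _)))) ⟩
    sum (λ x → u (inj₁ x) + χ jumps x) + sumT u
      ≡⟨ cong (_+ sumT u) (trans (∑-distrib-+ (λ x → u (inj₁ x)) (χ jumps)) (cong (sumV u +_) (sum-χ jumps))) ⟩
    sumV u + ∣ jumps ∣ + sumT u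
      ≡⟨ xy∙z≈xz∙y (sumV u) ∣ jumps ∣ (sumT u) ⟩
    sumV u + sumT u + ∣ jumps ∣ ∎)
    where open ≤-Reasoning

  -- As there are more nodes inj₂ t than elements, some inj₂ t is matched to an
  -- inj₂ t′, and so τ = u (inj₂ t) = v (inj₂ t′) bounds v from above on the
  -- elements while τ - k bounds u from below: only k levels are possible.
  anchor : ∃ λ t → InT (f (inj₂ t))
  anchor with any? (λ t → inT? (f (inj₂ t)))
  ... | yes a = a
  ... | no ¬a = contradiction (λ {s} {t} → g-injective {s} {t}) (<⇒notInjective {f = g} ≤-refl)
    where
    image : ∀ t → ∃ λ x → f (inj₂ t) ≡ inj₁ x
    image t with f (inj₂ t) in eq
    ... | inj₁ x  = x , refl
    ... | inj₂ t′ = contradiction (t , t′ , eq) ¬a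
    g : Fin (suc n) → Fin n
    g t = proj₁ (image t)
    g-injective : Injective _≡_ _≡_ g
    g-injective {s} {t} eq = inj₂-injective (f-injective
      (trans (proj₂ (image s)) (trans (cong inj₁ eq) (sym (proj₂ (image t))))))

  τ : ℕ
  τ = u (inj₂ (proj₁ anchor))

  v≤τ : ∀ x → v (inj₁ x) ≤ τ
  v≤τ x = ≤-trans (dual-feasible (inj₂ (proj₁ anchor)) (inj₁ x) _) (≤-reflexive (+-identityʳ τ))

  τ≤u+k : ∀ x → τ ≤ u (inj₁ x) + k
  τ≤u+k x with anchor
  ... | t , t′ , eq = begin
    u (inj₂ t)         ≡⟨ +-identityʳ _ ⟨
    u (inj₂ t) + 0     ≡⟨ f-equality (inj₂ t) ⟨
    v (f (inj₂ t))     ≡⟨ cong v eq ⟩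
    v (inj₂ t′)        ≤⟨ dual-feasible (inj₁ x) (inj₂ t′) _ ⟩
    u (inj₁ x) + k     ∎
    where open ≤-Reasoning

  -- The index `i` is `u (inj₁ x) - (τ - k)`, written without subtraction.
  Level : ℕ → Fin n → Set
  Level i x = Jump x × u (inj₁ x) + k ≡ τ + i

  level? : ∀ i x → Dec (Level i x)
  level? i x = jump? x ×-dec (u (inj₁ x) + k ℕ.≟ τ + i)

  level : ℕ → Subset n
  level i = comprehension (level? i)

  -- A proper edge `x ≼ y` is free, so `v` at `y` is at most `u` at `x`. If `y` is a jump, `u`
  -- therefore drops strictly from `x` to `y`, and the two cannot share a level.
  level-antichain : ∀ i → IsAntichain Q (level i)
  level-antichain i x y x∈ y∈ x≼y with x ≟ y
  ... | yes x≡y = x≡y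
  ... | no  x≢y with ∈-comprehension⁻ (level? i) x∈ | ∈-comprehension⁻ (level? i) y∈
  ...   | _ , ux | jy , uy = contradiction (begin
    suc (u (inj₁ y))   ≡⟨ jy ⟨
    v (inj₁ y)         ≤⟨ dual-feasible (inj₁ x) (inj₁ y) x≼y ⟩
    u (inj₁ x) + cost (inj₁ x) (inj₁ y)   ≡⟨ cong (u (inj₁ x) +_) cost≡0 ⟩
    u (inj₁ x) + 0     ≡⟨ +-identityʳ _ ⟩
    u (inj₁ x)         ≡⟨ +-cancelʳ-≡ k _ _ (trans ux (sym uy)) ⟩
    u (inj₁ y)         ∎) (<-irrefl refl)
    where
    open ≤-Reasoning
    cost≡0 : cost (inj₁ x) (inj₁ y) ≡ 0
    cost≡0 with x ≟ y
    ... | yes x≡y = contradiction x≡y x≢y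
    ... | no  _   = refl

  levels : List (Subset n)
  levels = map level (upTo k)

  jumps⊆levels : jumps ⊆ ⋃ levels
  jumps⊆levels {x} x∈ = ∈-⋃⁺ (Any.map⁺ (LM.lose (∈-upTo⁺ i<k) (∈-comprehension⁺ (level? i) (jx , sym τ+i))))
    where
    jx = ∈-comprehension⁻ jump? x∈
    i = u (inj₁ x) + k ∸ τ
    τ+i : τ + i ≡ u (inj₁ x) + k
    τ+i = m+[n∸m]≡n (τ≤u+k x)
    -- A jump has `u` < `v` ≤ `τ`, so `u + k` stays below `τ + k`.
    i<k : i < k
    i<k = +-cancelˡ-< τ i k (begin-strict
      τ + i            ≡⟨ τ+i ⟩
      u (inj₁ x) + k   <⟨ +-monoˡ-< k (subst (_≤ τ) jx (v≤τ x)) ⟩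
      τ + k            ∎)
      where open ≤-Reasoning

  -- Chains traced by the matching

  _⟶_ : Fin n → Fin n → Set
  x ⟶ y = f (inj₁ x) ≡ inj₁ y

  -- Successors go strictly up in the order, so following them terminates. A path cannot run into a
  -- rest element: that element is already matched to itself, and the matching is injective.
  fate : ∀ x → Rest x ⊎ ∃ λ e → End e × Star _⟶_ x e
  fate x = go x (po-noetherian isPartialOrder x)
    where
    go : ∀ x → Acc _ x → Rest x ⊎ ∃ λ e → End e × Star _⟶_ x e
    go x (acc rec) with f (inj₁ x) in eq | f-edge (inj₁ x)
    ... | inj₂ t | _   = inj₂ (x , (t , eq) , ε)
    ... | inj₁ y | x≼y with x ≟ y
    ...   | yes refl = inj₁ refl
    ...   | no  x≢y with go y (rec (x≼y , x≢y))
    ...     | inj₁ y-rest = contradiction (inj₁-injective (f-injective (trans eq (sym y-rest)))) x≢y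
    ...     | inj₂ (e , e-end , path) = inj₂ (e , e-end , eq ◅ path)

  path-≼ : ∀ {x y} → Star _⟶_ x y → x ≼ y
  path-≼ = fold _≼_ (λ {x} x⟶y → ≼-trans (subst (Edge (inj₁ x)) x⟶y (f-edge (inj₁ x)))) ≼-refl

  path-last : ∀ {x y} → Star _⟶_ x y → x ≡ y ⊎ ∃ λ z → Star _⟶_ x z × z ⟶ y
  path-last ε = inj₁ refl
  path-last (s ◅ p) with path-last p
  ... | inj₁ refl        = inj₂ (_ , ε , s)
  ... | inj₂ (z , q , t) = inj₂ (z , s ◅ q , t)

  -- By injectivity of `f` predecessors are unique, so of two paths into the same `e` one is a final
  -- segment of the other.
  paths-comparable : ∀ {x y e} → Star _⟶_ x e → Star _⟶_ y e → Star _⟶_ x y ⊎ Star _⟶_ y x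
  paths-comparable ε q = inj₂ q
  paths-comparable {x} (s ◅ p) q with paths-comparable p q
  ... | inj₁ x′y = inj₁ (s ◅ x′y)
  ... | inj₂ yx′ with path-last yx′
  ...   | inj₁ refl = inj₁ (s ◅ ε)
  ...   | inj₂ (z , yz , t) =
    inj₂ (subst (Star _⟶_ _) (inj₁-injective (f-injective (trans t (sym s)))) yz)

  EndsIn : Fin n → ∀ {x} → Rest x ⊎ (∃ λ e → End e × Star _⟶_ x e) → Set
  EndsIn e (inj₁ _)        = Empty
  EndsIn e (inj₂ (e′ , _)) = e′ ≡ e

  endsIn? : ∀ e {x} (r : Rest x ⊎ (∃ λ e → End e × Star _⟶_ x e)) → Dec (EndsIn e r)
  endsIn? e (inj₁ _)        = no λ ()
  endsIn? e (inj₂ (e′ , _)) = e′ ≟ e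

  chainTo : Fin n → Subset n
  chainTo e = comprehension (λ x → endsIn? e (fate x))

  chainTo-path : ∀ {e x} → x ∈ chainTo e → Star _⟶_ x e
  chainTo-path {e} {x} x∈ with fate x | ∈-comprehension⁻ (λ x → endsIn? e (fate x)) x∈
  ... | inj₂ (_ , _ , path) | refl = path

  chainTo-chain : ∀ e → IsChain Q (chainTo e)
  chainTo-chain e x y x∈ y∈ with paths-comparable (chainTo-path x∈) (chainTo-path y∈)
  ... | inj₁ p = inj₁ (path-≼ p)
  ... | inj₂ p = inj₂ (path-≼ p)

  covered : ∀ x → x ∈ rests ⊎ Any (x ∈_) (map chainTo (elements ends))
  covered x with fate x in eq
  ... | inj₁ r = inj₁ (∈-comprehension⁺ rest? r)
  ... | inj₂ (e , e-end , p) = inj₂ (Any.map⁺ (LM.lose (∈-elements⁺ (∈-comprehension⁺ end? e-end))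
          (∈-comprehension⁺ (λ x → endsIn? e (fate x)) (subst (EndsIn e) (sym eq) refl))))

  saturatedPartition : SaturatedPartition Q k
  saturatedPartition = record
    { family       = ⋃ levels
    ; isKAntichain = levels , trans (length-map level (upTo k)) (length-upTo k)
                   , All.map⁺ (All.universal level-antichain (upTo k)) , refl
    ; chains       = map chainTo (elements ends)
    ; areChains    = All.map⁺ (All.universal chainTo-chain (elements ends))
    ; rest         = rests
    ; covers       = covered
    ; saturated    = begin
        length (map chainTo (elements ends)) * k + ∣ rests ∣
          ≡⟨ cong (λ l → l * k + ∣ rests ∣) (trans (length-map chainTo (elements ends)) (length-elements ends)) ⟩
        ∣ ends ∣ * k + ∣ rests ∣  ≤⟨ size-bound ⟩
        ∣ jumps ∣                 ≤⟨ p⊆q⇒∣p∣≤∣q∣ jumps⊆levels ⟩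
        ∣ ⋃ levels ∣              ∎
    }
    where open ≤-Reasoning

abstract
  greene-kleitman : ∀ Q k → SaturatedPartition Q k
  greene-kleitman Q k = SaturatedFromOptimum.saturatedPartition Q k (Network.optimum Q k)

-- A decomposition brings its own height, width and maxima; this identifies them with those named in
-- the theorem.
MaxSize-unique : ∀ {n} {A : Subset n → Set} {k l} → MaxSize A k → MaxSize A l → k ≡ l
MaxSize-unique ((S , aS , refl) , k-max) ((T , aT , refl) , l-max) =
  ≤-antisym (l-max S aS) (k-max T aT)

-- Disjoint families

sizes : ∀ {n} → List (Subset n) → List ℕ
sizes = map ∣_∣

disjoint-∉ : ∀ {n} {A : Subset n} {Bs x} → All (λ B → A ∩ B ≡ ⊥) Bs → x ∈ A → ¬ Any (x ∈_) Bs
disjoint-∉ (A∩B≡⊥ ∷ _) x∈A (here x∈B)  = ∉⊥ (subst (_ ∈_) A∩B≡⊥ (x∈p∩q⁺ (x∈A , x∈B)))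
disjoint-∉ (_ ∷ dis)   x∈A (there x∈B) = disjoint-∉ dis x∈A x∈B

∣⋃∣-disjoint : ∀ {n} {As : List (Subset n)} → Disjoint As → ∣ ⋃ As ∣ ≡ sumᴸ (sizes As)
∣⋃∣-disjoint {n} []                    = ∣⊥∣≡0 n
∣⋃∣-disjoint {n} {A ∷ As} (dis ∷ disj) = begin
  ∣ A ∪ ⋃ As ∣                  ≡⟨ +-identityʳ _ ⟨
  ∣ A ∪ ⋃ As ∣ + 0              ≡⟨ cong (∣ A ∪ ⋃ As ∣ +_) (trans (cong ∣_∣ (Empty-unique empty)) (∣⊥∣≡0 n)) ⟨
  ∣ A ∪ ⋃ As ∣ + ∣ A ∩ ⋃ As ∣   ≡⟨ ∣p∪q∣+∣p∩q∣≡∣p∣+∣q∣ A (⋃ As) ⟩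
  ∣ A ∣ + ∣ ⋃ As ∣              ≡⟨ cong (∣ A ∣ +_) (∣⋃∣-disjoint disj) ⟩
  ∣ A ∣ + sumᴸ (sizes As)       ∎
  where
  open ≡-Reasoning
  empty : ¬ ∃ λ x → x ∈ A ∩ ⋃ As
  empty (x , x∈) with x∈p∩q⁻ A (⋃ As) x∈
  ... | x∈A , x∈⋃ = disjoint-∉ dis x∈A (∈-⋃⁻ As x∈⋃)

∣⋃-take∣ : ∀ {n} {As : List (Subset n)} → Disjoint As → ∀ k → ∣ ⋃ (take k As) ∣ ≡ sumᴸ (take k (sizes As))
∣⋃-take∣ {As = As} disj k = trans (∣⋃∣-disjoint (AllPairs.take⁺ k disj)) (cong sumᴸ (sym (take-map k As)))

∣⋃∣-cover : ∀ {n} (S : Subset n) Cs → ∣ S ∩ ⋃ Cs ∣ ≤ sumᴸ (map (λ C → ∣ C ∩ S ∣) Cs)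
∣⋃∣-cover {n} S []   = ≤-reflexive (trans (cong ∣_∣ (∩-zeroʳ S)) (∣⊥∣≡0 n))
∣⋃∣-cover S (C ∷ Cs) = begin
  ∣ S ∩ (C ∪ ⋃ Cs) ∣            ≡⟨ cong ∣_∣ (∩-distribˡ-∪ S C (⋃ Cs)) ⟩
  ∣ (S ∩ C) ∪ (S ∩ ⋃ Cs) ∣      ≤⟨ ∣p∪q∣≤∣p∣+∣q∣ (S ∩ C) (S ∩ ⋃ Cs) ⟩
  ∣ S ∩ C ∣ + ∣ S ∩ ⋃ Cs ∣      ≤⟨ +-mono-≤ (≤-reflexive (cong ∣_∣ (∩-comm S C))) (∣⋃∣-cover S Cs) ⟩
  ∣ C ∩ S ∣ + sumᴸ (map (λ C → ∣ C ∩ S ∣) Cs) ∎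
  where open ≤-Reasoning

subsingleton-size : ∀ {n} (p : Subset n) → (∀ {x y} → x ∈ p → y ∈ p → x ≡ y) → ∣ p ∣ ≤ 1
subsingleton-size {n} p unique with nonempty? p
... | yes (x , x∈p) = ≤-trans (p⊆q⇒∣p∣≤∣q∣ (λ y∈p → subst (_∈ ⁅ x ⁆) (unique x∈p y∈p) (x∈⁅x⁆ x)))
                        (≤-reflexive (∣⁅x⁆∣≡1 x))
... | no empty = ≤-trans (≤-reflexive (trans (cong ∣_∣ (Empty-unique empty)) (∣⊥∣≡0 n))) z≤n

-- Saturated partitions only promise a cover, while k-chains ask for disjoint chains. Each set gives
-- up what later sets contain, which keeps the union and the number of sets.
disjointify : ∀ {n} → List (Subset n) → List (Subset n)
disjointify []       = []
disjointify (C ∷ Cs) = (C ─ ⋃ Cs) ∷ disjointify Cs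

length-disjointify : ∀ {n} (Cs : List (Subset n)) → length (disjointify Cs) ≡ length Cs
length-disjointify []       = refl
length-disjointify (C ∷ Cs) = cong suc (length-disjointify Cs)

disjointify-⊆ : ∀ {n} (Cs : List (Subset n)) → All (_⊆ ⋃ Cs) (disjointify Cs)
disjointify-⊆ []       = []
disjointify-⊆ (C ∷ Cs) = (λ x∈ → x∈p∪q⁺ (inj₁ (p─q⊆p C (⋃ Cs) x∈)))
                       ∷ All.map {P = _⊆ ⋃ Cs} {Q = _⊆ ⋃ (C ∷ Cs)}
                           (λ ⊆⋃ {x} x∈ → x∈p∪q⁺ (inj₂ (⊆⋃ x∈))) (disjointify-⊆ Cs)

disjointify-disjoint : ∀ {n} (Cs : List (Subset n)) → Disjoint (disjointify Cs)
disjointify-disjoint []       = []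
disjointify-disjoint (C ∷ Cs) =
  All.map {P = _⊆ ⋃ Cs} (λ {B} B⊆ → Empty-unique (empty B B⊆)) (disjointify-⊆ Cs) ∷ disjointify-disjoint Cs
  where
  empty : ∀ B → B ⊆ ⋃ Cs → ¬ ∃ λ x → x ∈ (C ─ ⋃ Cs) ∩ B
  empty B B⊆ (x , x∈) with x∈p∩q⁻ (C ─ ⋃ Cs) B x∈
  ... | x∈─ , x∈B = x∈p─q⇒x∉q C (⋃ Cs) x∈─ (B⊆ x∈B)

⋃-disjointify : ∀ {n} (Cs : List (Subset n)) → ⋃ Cs ⊆ ⋃ (disjointify Cs)
⋃-disjointify []       x∈ = x∈
⋃-disjointify (C ∷ Cs) {x} x∈ with x ∈? ⋃ Cs
... | yes x∈⋃ = x∈p∪q⁺ (inj₂ (⋃-disjointify Cs x∈⋃))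
... | no  x∉⋃ with x∈p∪q⁻ C (⋃ Cs) x∈
...   | inj₁ x∈C = x∈p∪q⁺ (inj₁ (x∈p∧x∉q⇒x∈p─q x∈C x∉⋃))
...   | inj₂ x∈⋃ = contradiction x∈⋃ x∉⋃

-- The first `r` minima are bounded by `k`, the others by the entries themselves.
Σmin-split : ∀ k r xs → sumᴸ (map (_⊓ k) xs) ≤ r * k + sumᴸ (drop r xs)
Σmin-split k zero    []       = z≤n
Σmin-split k zero    (x ∷ xs) = +-mono-≤ (m⊓n≤m x k) (Σmin-split k zero xs)
Σmin-split k (suc r) []       = z≤n
Σmin-split k (suc r) (x ∷ xs) = ≤-trans (+-mono-≤ (m⊓n≤n x k) (Σmin-split k r xs))
                                  (≤-reflexive (sym (+-assoc k (r * k) _)))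

-- Chains and antichains in one poset

module _ (P : FinPoset) where
  open FinPoset P

  chain-⊆ : ∀ {C D} → D ⊆ C → IsChain P C → IsChain P D
  chain-⊆ D⊆C chain x y x∈ y∈ = chain x y (D⊆C x∈) (D⊆C y∈)

  disjointify-chains : ∀ {Cs} → All (IsChain P) Cs → All (IsChain P) (disjointify Cs)
  disjointify-chains []                     = []
  disjointify-chains {C ∷ Cs} (chain ∷ chains) =
    chain-⊆ {C} (p─q⊆p C (⋃ Cs)) chain ∷ disjointify-chains chains

  ∣⋃-chains∣≤c : ∀ {c} → IsCFun P c → ∀ {Cs} → All (IsChain P) Cs → ∣ ⋃ Cs ∣ ≤ c (length Cs)
  ∣⋃-chains∣≤c isC {Cs} chains = ≤-trans (p⊆q⇒∣p∣≤∣q∣ (⋃-disjointify Cs))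
    (proj₂ (isC (length Cs)) _ (disjointify Cs , length-disjointify Cs , disjointify-chains chains
      , disjointify-disjoint Cs , refl))

  ∣chain∩antichain∣≤1 : ∀ {C A} → IsChain P C → IsAntichain P A → ∣ C ∩ A ∣ ≤ 1
  ∣chain∩antichain∣≤1 {C} {A} chain anti = subsingleton-size (C ∩ A) unique
    where
    unique : ∀ {x y} → x ∈ C ∩ A → y ∈ C ∩ A → x ≡ y
    unique {x} {y} x∈ y∈ with x∈p∩q⁻ C A x∈ | x∈p∩q⁻ C A y∈
    ... | x∈C , x∈A | y∈C , y∈A with chain x y x∈C y∈C
    ...   | inj₁ x≼y = anti x y x∈A y∈A x≼y
    ...   | inj₂ y≼x = sym (anti y x y∈A x∈A y≼x)

  ∣chain∩⋃-antichains∣≤ : ∀ {C} → IsChain P C → ∀ {As} → All (IsAntichain P) As → ∣ C ∩ ⋃ As ∣ ≤ length As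
  ∣chain∩⋃-antichains∣≤ {C} chain [] = ≤-reflexive (trans (cong ∣_∣ (∩-zeroʳ C)) (∣⊥∣≡0 size))
  ∣chain∩⋃-antichains∣≤ {C} chain {A ∷ As} (anti ∷ antis) = begin
    ∣ C ∩ (A ∪ ⋃ As) ∣         ≡⟨ cong ∣_∣ (∩-distribˡ-∪ C A (⋃ As)) ⟩
    ∣ (C ∩ A) ∪ (C ∩ ⋃ As) ∣   ≤⟨ ∣p∪q∣≤∣p∣+∣q∣ (C ∩ A) (C ∩ ⋃ As) ⟩
    ∣ C ∩ A ∣ + ∣ C ∩ ⋃ As ∣   ≤⟨ +-mono-≤ (∣chain∩antichain∣≤1 {C} {A} chain anti) (∣chain∩⋃-antichains∣≤ chain antis) ⟩
    suc (length As)            ∎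
    where open ≤-Reasoning

  module _ {d : ℕ → ℕ} (isD : IsDFun P d) where

    d-zero : d 0 ≡ 0
    d-zero with proj₁ (isD 0)
    ... | _ , ([] , _ , _ , refl) , ∣S∣≡d = trans (sym ∣S∣≡d) (∣⊥∣≡0 size)

    d-step : ∀ k → d k ≤ d (suc k)
    d-step k with proj₁ (isD k)
    ... | S , (As , len , antis , refl) , ∣S∣≡d = subst (_≤ d (suc k)) ∣S∣≡d
      (proj₂ (isD (suc k)) (⋃ As) (⊥ ∷ As , cong suc len
        , (λ _ _ x∈ → contradiction x∈ ∉⊥) ∷ antis , sym (∪-identityˡ (⋃ As))))

    d-mono : ∀ {k l} → k ≤ l → d k ≤ d l
    d-mono {l = l} k≤l = go l k≤l
      where
      go : ∀ {k} l → k ≤ l → d k ≤ d l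
      go {k} zero    z≤n = ≤-refl
      go {k} (suc l) k≤1+l with m≤n⇒m<n∨m≡n k≤1+l
      ... | inj₁ (s≤s k≤l) = ≤-trans (go l k≤l) (d-step l)
      ... | inj₂ refl      = ≤-refl

    d≤size : ∀ k → d k ≤ size
    d≤size k with proj₁ (isD k)
    ... | S , _ , ∣S∣≡d = subst (_≤ size) ∣S∣≡d (∣p∣≤n S)

  -- Greene's duality: a c-decomposition is k-saturated for every k.  For a
  -- k-saturated partition with r chains, n - |rest| ≤ c r, whence
  -- Σ min(λ_j, k) ≤ r k + (n - c r) ≤ r k + |rest| ≤ d k.
  module _ {Cs : List (Subset size)} (chains : All (IsChain P) Cs) (disj : Disjoint Cs) (total : ⋃ Cs ≡ ⊤)
           {d c : ℕ → ℕ} (isD : IsDFun P d) (isC : IsCFun P c)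
           (maxima : ∀ k → k ≤ length Cs → c k ≡ sumᴸ (take k (sizes Cs))) where

    sum-sizes : sumᴸ (sizes Cs) ≡ size
    sum-sizes = trans (sym (∣⋃∣-disjoint disj)) (trans (cong ∣_∣ total) (∣⊤∣≡n size))

    -- The easy half: a chain `C` contributes to a k-antichain at most `k` elements, and at most all
    -- of its own.
    d≤Σmin : ∀ k → d k ≤ sumᴸ (map (_⊓ k) (sizes Cs))
    d≤Σmin k with proj₁ (isD k)
    ... | S , (As , len , antis , refl) , ∣S∣≡d = begin
      d k                                ≡⟨ ∣S∣≡d ⟨
      ∣ S ∣                              ≡⟨ cong ∣_∣ (∩-identityʳ S) ⟨
      ∣ S ∩ ⊤ ∣                          ≡⟨ cong (λ T → ∣ S ∩ T ∣) total ⟨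
      ∣ S ∩ ⋃ Cs ∣                       ≤⟨ ∣⋃∣-cover S Cs ⟩
      sumᴸ (map (λ C → ∣ C ∩ S ∣) Cs)    ≤⟨ termwise chains ⟩
      sumᴸ (map (_⊓ k) (sizes Cs))       ∎
      where
      open ≤-Reasoning
      termwise : ∀ {Ds} → All (IsChain P) Ds → sumᴸ (map (λ C → ∣ C ∩ S ∣) Ds) ≤ sumᴸ (map (_⊓ k) (sizes Ds))
      termwise []                         = z≤n
      termwise {D ∷ Ds} (chain ∷ chains) = +-mono-≤
        (⊓-glb (∣p∩q∣≤∣p∣ D S) (subst (∣ D ∩ S ∣ ≤_) len (∣chain∩⋃-antichains∣≤ chain antis)))
        (termwise chains)

    -- The `r` needed below is the number of chains of a saturated partition, which may exceed
    -- `length Cs`. Beyond that length `take r` already collects all of `size`, a bound for every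
    -- `c r`.
    c≤take : ∀ r → c r ≤ sumᴸ (take r (sizes Cs))
    c≤take r with ≤-total r (length Cs)
    ... | inj₁ r≤w = ≤-reflexive (maxima r r≤w)
    ... | inj₂ w≤r with proj₁ (isC r)
    ...   | S , _ , ∣S∣≡c = subst (_≤ _) ∣S∣≡c (≤-trans (∣p∣≤n S) (≤-reflexive (trans (sym sum-sizes)
              (cong sumᴸ (sym (take-all r (sizes Cs) (subst (_≤ r) (sym (length-map ∣_∣ Cs)) w≤r)))))))

    Σmin≤d : ∀ k → sumᴸ (map (_⊓ k) (sizes Cs)) ≤ d k
    Σmin≤d k = begin
      sumᴸ (map (_⊓ k) (sizes Cs))             ≤⟨ Σmin-split k r (sizes Cs) ⟩
      r * k + sumᴸ (drop r (sizes Cs))         ≤⟨ +-monoʳ-≤ (r * k) (+-cancelˡ-≤ (sumᴸ (take r (sizes Cs))) _ _ drop≤) ⟩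
      r * k + ∣ rest ∣                         ≤⟨ saturated ⟩
      ∣ family ∣                               ≤⟨ proj₂ (isD k) family isKAntichain ⟩
      d k                                      ∎
      where
      open ≤-Reasoning
      open SaturatedPartition (greene-kleitman P k) renaming (chains to Ds)
      r = length Ds
      everything : ⊤ ⊆ ⋃ Ds ∪ rest
      everything {x} _ with covers x
      ... | inj₁ x∈rest = x∈p∪q⁺ (inj₂ x∈rest)
      ... | inj₂ x∈Ds   = x∈p∪q⁺ (inj₁ (∈-⋃⁺ x∈Ds))
      drop≤ : sumᴸ (take r (sizes Cs)) + sumᴸ (drop r (sizes Cs)) ≤ sumᴸ (take r (sizes Cs)) + ∣ rest ∣
      drop≤ = begin
        sumᴸ (take r (sizes Cs)) + sumᴸ (drop r (sizes Cs))  ≡⟨ sum-++ (take r (sizes Cs)) _ ⟨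
        sumᴸ (take r (sizes Cs) ++ drop r (sizes Cs))        ≡⟨ cong sumᴸ (take++drop≡id r (sizes Cs)) ⟩
        sumᴸ (sizes Cs)                                      ≡⟨ sum-sizes ⟩
        size                                                 ≡⟨ ∣⊤∣≡n size ⟨
        ∣ ⊤ {size} ∣                                         ≤⟨ p⊆q⇒∣p∣≤∣q∣ everything ⟩
        ∣ ⋃ Ds ∪ rest ∣                                      ≤⟨ ∣p∪q∣≤∣p∣+∣q∣ (⋃ Ds) rest ⟩
        ∣ ⋃ Ds ∣ + ∣ rest ∣                                  ≤⟨ +-monoˡ-≤ ∣ rest ∣ (≤-trans (∣⋃-chains∣≤c isC areChains) (c≤take r)) ⟩
        sumᴸ (take r (sizes Cs)) + ∣ rest ∣                  ∎

    greene : ∀ k → d k ≡ sumᴸ (map (_⊓ k) (sizes Cs))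
    greene k = ≤-antisym (d≤Σmin k) (Σmin≤d k)

-- Sums over 1, …, n

sum1to-cong : ∀ n {f g} → (∀ i → f (suc i) ≡ g (suc i)) → sum1to n f ≡ sum1to n g
sum1to-cong zero    f≗g = refl
sum1to-cong (suc n) f≗g = cong₂ _+_ (sum1to-cong n f≗g) (f≗g n)

sum1to-suc : ∀ n f → sum1to (suc n) f ≡ f 1 + sum1to n (λ i → f (suc i))
sum1to-suc zero    f = +-comm 0 (f 1)
sum1to-suc (suc n) f = trans (cong (_+ f (suc (suc n))) (sum1to-suc n f)) (+-assoc (f 1) _ _)

sum1to-+ : ∀ n f g → sum1to n (λ i → f i + g i) ≡ sum1to n f + sum1to n g
sum1to-+ zero    f g = refl
sum1to-+ (suc n) f g = trans (cong (_+ (f (suc n) + g (suc n))) (sum1to-+ n f g))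
                         (interchange (sum1to n f) (sum1to n g) (f (suc n)) (g (suc n)))

sum1to-zero : ∀ n → sum1to n (λ _ → 0) ≡ 0
sum1to-zero zero    = refl
sum1to-zero (suc n) = trans (+-identityʳ _) (sum1to-zero n)

-- Moves the upper limit from min(h(P), h(Q)) to h(P), a bound for all chain sizes of P, as
-- conjugation requires.
sum1to-⊓ : ∀ m n {f} → (∀ i → n ≤ i → f (suc i) ≡ 0) → sum1to m f ≡ sum1to (m ⊓ n) f
sum1to-⊓ zero    n vanish = refl
sum1to-⊓ (suc m) n {f} vanish with suc m ≤? n
... | yes m<n = cong (λ l → sum1to l f) (sym (m≤n⇒m⊓n≡m m<n))
... | no  m≮n = begin
  sum1to m f + f (suc m)  ≡⟨ cong₂ _+_ (sum1to-⊓ m n vanish) (vanish m n≤m) ⟩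
  sum1to (m ⊓ n) f + 0    ≡⟨ +-identityʳ _ ⟩
  sum1to (m ⊓ n) f        ≡⟨ cong (λ l → sum1to l f) (trans (m≥n⇒m⊓n≡n n≤m) (sym (m≥n⇒m⊓n≡n (m≤n⇒m≤1+n n≤m)))) ⟩
  sum1to (suc m ⊓ n) f    ∎
  where
  open ≡-Reasoning
  n≤m : n ≤ m
  n≤m = ≤-pred (≰⇒> m≮n)

-- The offset `a` is the sum of the entries already removed: passing to the tail shifts `c` by one
-- index and adds the head to `a`, and `diff` cancels it.
PartialSums : ℕ → (ℕ → ℕ) → List ℕ → Set
PartialSums a c xs = ∀ k → k ≤ length xs → c k ≡ a + sumᴸ (take k xs)

partialSums-head : ∀ {a c x xs} → PartialSums a c (x ∷ xs) → diff c 1 ≡ x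
partialSums-head {a} {c} {x} ps = begin
  c 1 ∸ c 0              ≡⟨ cong₂ _∸_ (ps 1 (s≤s z≤n)) (ps 0 z≤n) ⟩
  (a + (x + 0)) ∸ (a + 0)  ≡⟨ [m+n]∸[m+o]≡n∸o a (x + 0) 0 ⟩
  x + 0                  ≡⟨ +-identityʳ x ⟩
  x                      ∎
  where open ≡-Reasoning

partialSums-tail : ∀ {a c x xs} → PartialSums a c (x ∷ xs) → PartialSums (a + x) (c ∘ suc) xs
partialSums-tail {a} ps k k≤ = trans (ps (suc k) (s≤s k≤)) (sym (+-assoc a _ _))

sum-of-diffs : ∀ (F : ℕ → ℕ) {a c} xs → PartialSums a c xs →
               sum1to (length xs) (λ j → F (diff c j)) ≡ sumᴸ (map F xs)
sum-of-diffs F []       ps = refl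
sum-of-diffs F {a} {c} (x ∷ xs) ps = begin
  sum1to (suc (length xs)) (λ j → F (diff c j))
    ≡⟨ sum1to-suc (length xs) (λ j → F (diff c j)) ⟩
  F (diff c 1) + sum1to (length xs) (λ j → F (diff c (suc j)))
    -- Shifting `diff c` agrees with `diff (c ∘ suc)` only at positive indices, since `diff` is 0 at
    -- index 0; `sum1to-cong` compares no others.
    ≡⟨ cong₂ _+_ (cong F (partialSums-head {a} ps)) (sum1to-cong (length xs) (λ _ → refl)) ⟩
  F x + sum1to (length xs) (λ j → F (diff (c ∘ suc) j))
    ≡⟨ cong (F x +_) (sum-of-diffs F xs (partialSums-tail ps)) ⟩
  F x + sumᴸ (map F xs) ∎
  where open ≡-Reasoning

sum-of-diff-products : ∀ {a b c d} xs ys → PartialSums a c xs → PartialSums b d ys →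
  sum1to (length xs ⊓ length ys) (λ i → diff c i * diff d i) ≡ sumᴸ (zipWith _*_ xs ys)
sum-of-diff-products []       _        ps qs = refl
sum-of-diff-products (x ∷ xs) []       ps qs = refl
sum-of-diff-products {a} {b} {c} {d} (x ∷ xs) (y ∷ ys) ps qs = begin
  sum1to (suc l) (λ i → diff c i * diff d i)
    ≡⟨ sum1to-suc l (λ i → diff c i * diff d i) ⟩
  diff c 1 * diff d 1 + sum1to l (λ i → diff c (suc i) * diff d (suc i))
    ≡⟨ cong₂ _+_ (cong₂ _*_ (partialSums-head {a} ps) (partialSums-head {b} qs)) (sum1to-cong l (λ _ → refl)) ⟩
  x * y + sum1to l (λ i → diff (c ∘ suc) i * diff (d ∘ suc) i)
    ≡⟨ cong (x * y +_) (sum-of-diff-products xs ys (partialSums-tail ps) (partialSums-tail qs)) ⟩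
  x * y + sumᴸ (zipWith _*_ xs ys) ∎
  where
  open ≡-Reasoning
  l = length xs ⊓ length ys

-- Conjugate partitions

atLeast : ℕ → ℕ → ℕ
atLeast i x = if does (i ≤? x) then 1 else 0

atLeast-≤ : ∀ {i x} → i ≤ x → atLeast i x ≡ 1
atLeast-≤ {i} {x} i≤x = cong (if_then 1 else 0) (dec-true (i ≤? x) i≤x)

atLeast-≰ : ∀ {i x} → ¬ i ≤ x → atLeast i x ≡ 0
atLeast-≰ {i} {x} i≰x = cong (if_then 1 else 0) (dec-false (i ≤? x) i≰x)

⊓-suc : ∀ x k → x ⊓ suc k ≡ atLeast (suc k) x + (x ⊓ k)
⊓-suc x k with suc k ≤? x
... | yes k<x = trans (m≥n⇒m⊓n≡n k<x) (sym (cong₂ _+_ (atLeast-≤ k<x) (m≥n⇒m⊓n≡n (<⇒≤ k<x))))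
... | no  k≮x = trans (m≤n⇒m⊓n≡m (m≤n⇒m≤1+n x≤k)) (sym (cong₂ _+_ (atLeast-≰ k≮x) (m≤n⇒m⊓n≡m x≤k)))
  where
  x≤k : x ≤ k
  x≤k = ≤-pred (≰⇒> k≮x)

-- The right side counts the entries that are at least `suc k`, which is a part of the conjugate
-- partition. Combined with `greene` it expresses μ^P through the chain sizes.
diff-Σmin : ∀ xs k → diff (λ k → sumᴸ (map (_⊓ k) xs)) (suc k) ≡ sumᴸ (map (atLeast (suc k)) xs)
diff-Σmin xs k = trans (cong (_∸ sumᴸ (map (_⊓ k) xs)) (split xs)) (m+n∸n≡m _ (sumᴸ (map (_⊓ k) xs)))
  where
  split : ∀ xs → sumᴸ (map (_⊓ suc k) xs) ≡ sumᴸ (map (atLeast (suc k)) xs) + sumᴸ (map (_⊓ k) xs)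
  split []       = refl
  split (x ∷ xs) = trans (cong₂ _+_ (⊓-suc x k) (split xs))
                     (interchange (atLeast (suc k) x) (x ⊓ k) (sumᴸ (map (atLeast (suc k)) xs)) _)

module _ {d : ℕ → ℕ} (d-zero : d 0 ≡ 0) (d-step : ∀ k → d k ≤ d (suc k)) where

  -- The factor `atLeast i x` stops the sum of differences at `x`; monotonicity of `d` makes the
  -- truncated subtractions exact.
  telescope : ∀ M x → sum1to M (λ i → atLeast i x * diff d i) ≡ d (x ⊓ M)
  telescope zero    x = trans (sym d-zero) (cong d (sym (⊓-zeroʳ x)))
  telescope (suc M) x with suc M ≤? x
  ... | yes M<x = begin
    sum1to M (λ i → atLeast i x * diff d i) + atLeast (suc M) x * diff d (suc M)
      ≡⟨ cong₂ _+_ (telescope M x) (trans (cong (_* diff d (suc M)) (atLeast-≤ M<x)) (*-identityˡ _)) ⟩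
    d (x ⊓ M) + (d (suc M) ∸ d M)  ≡⟨ cong (λ l → d l + (d (suc M) ∸ d M)) (m≥n⇒m⊓n≡n (<⇒≤ M<x)) ⟩
    d M + (d (suc M) ∸ d M)        ≡⟨ m+[n∸m]≡n (d-step M) ⟩
    d (suc M)                      ≡⟨ cong d (m≥n⇒m⊓n≡n M<x) ⟨
    d (x ⊓ suc M)                  ∎
    where open ≡-Reasoning
  ... | no  M≮x = begin
    sum1to M (λ i → atLeast i x * diff d i) + atLeast (suc M) x * diff d (suc M)
      ≡⟨ cong₂ _+_ (telescope M x) (cong (_* diff d (suc M)) (atLeast-≰ M≮x)) ⟩
    d (x ⊓ M) + 0   ≡⟨ +-identityʳ _ ⟩
    d (x ⊓ M)       ≡⟨ cong d (trans (m≤n⇒m⊓n≡m x≤M) (sym (m≤n⇒m⊓n≡m (m≤n⇒m≤1+n x≤M)))) ⟩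
    d (x ⊓ suc M)   ∎
    where
    open ≡-Reasoning
    x≤M : x ≤ M
    x≤M = ≤-pred (≰⇒> M≮x)

  -- Each `d x` is spread over its increments and the order of summation is exchanged: the increment
  -- at `i` occurs once for every entry that is at least `i`.
  Σd-conjugate : ∀ M xs → All (_≤ M) xs →
    sumᴸ (map d xs) ≡ sum1to M (λ i → sumᴸ (map (atLeast i) xs) * diff d i)
  Σd-conjugate M []       []           = sym (sum1to-zero M)
  Σd-conjugate M (x ∷ xs) (x≤M ∷ xs≤M) = begin
    d x + sumᴸ (map d xs)
      ≡⟨ cong₂ _+_ (trans (cong d (sym (m≤n⇒m⊓n≡m x≤M))) (sym (telescope M x))) (Σd-conjugate M xs xs≤M) ⟩
    sum1to M (λ i → atLeast i x * diff d i) + sum1to M (λ i → sumᴸ (map (atLeast i) xs) * diff d i)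
      ≡⟨ sum1to-+ M _ _ ⟨
    sum1to M (λ i → atLeast i x * diff d i + sumᴸ (map (atLeast i) xs) * diff d i)
      ≡⟨ sum1to-cong M (λ i → *-distribʳ-+ (diff d (suc i)) (atLeast (suc i) x) _) ⟨
    sum1to M (λ i → (atLeast i x + sumᴸ (map (atLeast i) xs)) * diff d i) ∎
    where open ≡-Reasoning

-- Semiantichains and unichain coverings

Unique-lookup-injective : ∀ {A : Set} {xs : List A} → Unique xs →
                          ∀ {i j} → List.lookup xs i ≡ List.lookup xs j → i ≡ j
Unique-lookup-injective (x∉ ∷ _) {zero}  {zero}  eq = refl
Unique-lookup-injective (x∉ ∷ _) {zero}  {suc j} eq = contradiction eq (All.lookup x∉ (∈-lookup j))
Unique-lookup-injective (x∉ ∷ _) {suc i} {zero}  eq = contradiction (sym eq) (All.lookup x∉ (∈-lookup i))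
Unique-lookup-injective (_ ∷ u)  {suc i} {suc j} eq = cong suc (Unique-lookup-injective u eq)

length-cartesianProduct : ∀ {A B : Set} (xs : List A) (ys : List B) →
                          length (cartesianProduct xs ys) ≡ length xs * length ys
length-cartesianProduct []       ys = refl
length-cartesianProduct (x ∷ xs) ys = trans (length-++ (map (x ,_) ys))
  (cong₂ _+_ (length-map (x ,_) ys) (length-cartesianProduct xs ys))

-- Only equal indices are paired, and the shorter list ends the pairing; hence the limit min(h(P),
-- h(Q)) in the sum.
blocks : ∀ {m n} → List (Subset m) → List (Subset n) → List (Fin m × Fin n)
blocks (A ∷ As) (B ∷ Bs) = cartesianProduct (elements A) (elements B) ++ blocks As Bs
blocks _        _        = []

length-blocks : ∀ {m n} (As : List (Subset m)) (Bs : List (Subset n)) →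
                length (blocks As Bs) ≡ sumᴸ (zipWith _*_ (sizes As) (sizes Bs))
length-blocks []       _        = refl
length-blocks (A ∷ As) []       = refl
length-blocks (A ∷ As) (B ∷ Bs) = trans (length-++ (cartesianProduct (elements A) (elements B)))
  (cong₂ _+_ (trans (length-cartesianProduct (elements A) (elements B))
                (cong₂ _*_ (length-elements A) (length-elements B)))
             (length-blocks As Bs))

module _ {m n : ℕ} where

  ∈-block⁻ : ∀ {x y} (A : Subset m) (B : Subset n) →
             (x , y) LM.∈ cartesianProduct (elements A) (elements B) → x ∈ A × y ∈ B
  ∈-block⁻ A B xy∈ with ∈-cartesianProduct⁻ (elements A) (elements B) xy∈
  ... | x∈ , y∈ = ∈-elements⁻ A x∈ , ∈-elements⁻ B y∈

  ∈-blocks⁻ : ∀ {x y} (As : List (Subset m)) (Bs : List (Subset n)) →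
              (x , y) LM.∈ blocks As Bs → Any (x ∈_) As × Any (y ∈_) Bs
  ∈-blocks⁻ (A ∷ As) (B ∷ Bs) xy∈ with ∈-++⁻ (cartesianProduct (elements A) (elements B)) xy∈
  ... | inj₁ xy∈AB = here (proj₁ (∈-block⁻ A B xy∈AB)) , here (proj₂ (∈-block⁻ A B xy∈AB))
  ... | inj₂ xy∈   = there (proj₁ (∈-blocks⁻ As Bs xy∈)) , there (proj₂ (∈-blocks⁻ As Bs xy∈))

  blocks-unique : ∀ {As : List (Subset m)} → Disjoint As → (Bs : List (Subset n)) → Unique (blocks As Bs)
  blocks-unique []           _        = []
  blocks-unique (_ ∷ _)      []       = []
  blocks-unique {A ∷ As} (dis ∷ disj) (B ∷ Bs) = Unique.++⁺
    (Unique.cartesianProduct⁺ (elements-unique A) (elements-unique B))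
    (blocks-unique disj Bs)
    (λ (∈AB , ∈rest) → disjoint-∉ dis (proj₁ (∈-block⁻ A B ∈AB)) (proj₁ (∈-blocks⁻ As Bs ∈rest)))

  -- Disjointness of `As` lets `u` determine its block, so `x` and `y` lie in one common `B`. The
  -- relation `R` will be the antichain property.
  blocks-sameˡ : ∀ {R : Fin n → Fin n → Set} {As : List (Subset m)} {Bs : List (Subset n)} → Disjoint As →
                 All (λ B → ∀ x y → x ∈ B → y ∈ B → R x y) Bs →
                 ∀ {u x y} → (u , x) LM.∈ blocks As Bs → (u , y) LM.∈ blocks As Bs → R x y
  blocks-sameˡ {As = A ∷ As} {B ∷ Bs} (dis ∷ disj) (r ∷ rs) p q
    with ∈-++⁻ (cartesianProduct (elements A) (elements B)) p
       | ∈-++⁻ (cartesianProduct (elements A) (elements B)) q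
  ... | inj₁ p | inj₁ q = r _ _ (proj₂ (∈-block⁻ A B p)) (proj₂ (∈-block⁻ A B q))
  ... | inj₁ p | inj₂ q = contradiction (proj₁ (∈-blocks⁻ As Bs q)) (disjoint-∉ dis (proj₁ (∈-block⁻ A B p)))
  ... | inj₂ p | inj₁ q = contradiction (proj₁ (∈-blocks⁻ As Bs p)) (disjoint-∉ dis (proj₁ (∈-block⁻ A B q)))
  ... | inj₂ p | inj₂ q = blocks-sameˡ disj rs p q

  blocks-sameʳ : ∀ {R : Fin m → Fin m → Set} {As : List (Subset m)} {Bs : List (Subset n)} → Disjoint Bs →
                 All (λ A → ∀ u v → u ∈ A → v ∈ A → R u v) As →
                 ∀ {u v x} → (u , x) LM.∈ blocks As Bs → (v , x) LM.∈ blocks As Bs → R u v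
  blocks-sameʳ {As = A ∷ As} {B ∷ Bs} (dis ∷ disj) (r ∷ rs) p q
    with ∈-++⁻ (cartesianProduct (elements A) (elements B)) p
       | ∈-++⁻ (cartesianProduct (elements A) (elements B)) q
  ... | inj₁ p | inj₁ q = r _ _ (proj₁ (∈-block⁻ A B p)) (proj₁ (∈-block⁻ A B q))
  ... | inj₁ p | inj₂ q = contradiction (proj₂ (∈-blocks⁻ As Bs q)) (disjoint-∉ dis (proj₂ (∈-block⁻ A B p)))
  ... | inj₂ p | inj₁ q = contradiction (proj₂ (∈-blocks⁻ As Bs p)) (disjoint-∉ dis (proj₂ (∈-block⁻ A B q)))
  ... | inj₂ p | inj₂ q = blocks-sameʳ disj rs p q

module _ (P Q : FinPoset) where
  open FinPoset P using () renaming (size to nP; _≼_ to _≼P_)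
  open FinPoset Q using () renaming (size to nQ; _≼_ to _≼Q_)

  weak-duality : ∀ {S F} → IsSemiantichain P Q S → IsUnichainCovering P Q F → length S ≤ length F
  weak-duality {S} {F} (unique , semi) cover = injective⇒≤ {f = assign} injective
    where
    assign : Fin (length S) → Fin (length F)
    assign i = Any.index (cover (List.lookup S i))
    injective : ∀ {i j} → assign i ≡ assign j → i ≡ j
    -- The semiantichain property only refutes `s ≢ t`; decidable equality of pairs turns this into
    -- an equation.
    injective {i} {j} eq = Unique-lookup-injective unique (decidable-stable
      (≡-dec _≟_ _≟_ (List.lookup S i) (List.lookup S j))
      (λ s≢t → semi _ _ (∈-lookup i) (∈-lookup j) s≢t (List.lookup F (assign i))
        ( Any.lookup-index (cover (List.lookup S i))
        , subst (λ l → _∈U_ P Q (List.lookup S j) (List.lookup F l)) (sym eq)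
            (Any.lookup-index (cover (List.lookup S j))))))

  blocks-semiantichain : ∀ {As Bs} → Disjoint As → All (IsAntichain P) As →
                         Disjoint Bs → All (IsAntichain Q) Bs → IsSemiantichain P Q (blocks As Bs)
  blocks-semiantichain {As} {Bs} disjA antiA disjB antiB = blocks-unique disjA Bs , independent
    where
    independent : ∀ s t → s LM.∈ blocks As Bs → t LM.∈ blocks As Bs → s ≢ t →
                  ∀ U → ¬ (_∈U_ P Q s U × _∈U_ P Q t U)
    independent (u , x) (_ , y) s∈ t∈ s≢t (fixP _ C chain) ((refl , x∈) , (refl , y∈)) with chain x y x∈ y∈
    ... | inj₁ x≼y = s≢t (cong (u ,_) (blocks-sameˡ {R = λ x y → x ≼Q y → x ≡ y} disjA antiB s∈ t∈ x≼y))
    ... | inj₂ y≼x = s≢t (cong (u ,_) (sym (blocks-sameˡ {R = λ x y → x ≼Q y → x ≡ y} disjA antiB t∈ s∈ y≼x)))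
    independent (u , x) (v , _) s∈ t∈ s≢t (fixQ C chain _) ((u∈ , refl) , (v∈ , refl)) with chain u v u∈ v∈
    ... | inj₁ u≼v = s≢t (cong (_, x) (blocks-sameʳ {R = λ u v → u ≼P v → u ≡ v} disjB antiA s∈ t∈ u≼v))
    ... | inj₂ v≼u = s≢t (cong (_, x) (sym (blocks-sameʳ {R = λ u v → u ≼P v → u ≡ v} disjB antiA t∈ s∈ v≼u)))

  rows : List (Fin nP) → ∀ {Ds} → All (IsChain Q) Ds → List (Unichain P Q)
  rows ps []               = []
  rows ps (chain ∷ chains) = map (λ p → fixP p _ chain) ps ++ rows ps chains

  length-rows : ∀ ps {Ds} (chains : All (IsChain Q) Ds) → length (rows ps chains) ≡ length Ds * length ps
  length-rows ps []               = refl
  length-rows ps (chain ∷ chains) = trans (length-++ (map (λ p → fixP p _ chain) ps))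
    (cong₂ _+_ (length-map _ ps) (length-rows ps chains))

  rows-cover : ∀ {ps u x Ds} (chains : All (IsChain Q) Ds) → u LM.∈ ps → Any (x ∈_) Ds →
               Any (_∈U_ P Q (u , x)) (rows ps chains)
  rows-cover (chain ∷ chains) u∈ (here x∈)  = Any.++⁺ˡ (Any.map⁺ (LM.lose u∈ (refl , x∈)))
  rows-cover {ps} (chain ∷ chains) u∈ (there x∈) =
    Any.++⁺ʳ (map (λ p → fixP p _ chain) ps) (rows-cover chains u∈ x∈)

  -- C × Q is covered by {p} × D for p ∈ C and D a chain of a |C|-saturated
  -- partition of Q, together with C × {q} for q in the rest.
  strip : ∀ {C} → IsChain P C → List (Unichain P Q)
  strip {C} chain = rows (elements C) areChains ++ map (fixQ C chain) (elements rest)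
    where open SaturatedPartition (greene-kleitman Q ∣ C ∣)

  strip-cover : ∀ {C} (chain : IsChain P C) {u} → u ∈ C → ∀ x → Any (_∈U_ P Q (u , x)) (strip chain)
  strip-cover {C} chain u∈C x with SaturatedPartition.covers (greene-kleitman Q ∣ C ∣) x
  ... | inj₂ x∈D    = Any.++⁺ˡ (rows-cover areChains (∈-elements⁺ u∈C) x∈D)
    where open SaturatedPartition (greene-kleitman Q ∣ C ∣)
  ... | inj₁ x∈rest = Any.++⁺ʳ (rows (elements C) areChains)
                        (Any.map⁺ (LM.lose (∈-elements⁺ x∈rest) (u∈C , refl)))
    where open SaturatedPartition (greene-kleitman Q ∣ C ∣)

  -- Here the choice `k` = |C| pays off: a chain D of Q costs |C| unichains, one for each `p` in C,
  -- and a rest element costs one, so the count is exactly the left side of `saturated`.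
  length-strip : ∀ {d} → IsDFun Q d → ∀ {C} (chain : IsChain P C) → length (strip chain) ≤ d ∣ C ∣
  length-strip {d} isD {C} chain = begin
    length (strip chain)
      ≡⟨ length-++ (rows (elements C) areChains) ⟩
    length (rows (elements C) areChains) + length (map (fixQ C chain) (elements rest))
      ≡⟨ cong₂ _+_ (trans (length-rows (elements C) areChains) (cong (length chains *_) (length-elements C)))
                   (trans (length-map _ (elements rest)) (length-elements rest)) ⟩
    length chains * ∣ C ∣ + ∣ rest ∣
      ≤⟨ saturated ⟩
    ∣ family ∣
      ≤⟨ proj₂ (isD ∣ C ∣) family isKAntichain ⟩
    d ∣ C ∣ ∎
    where
    open ≤-Reasoning
    open SaturatedPartition (greene-kleitman Q ∣ C ∣)

  strips : ∀ {Cs} → All (IsChain P) Cs → List (Unichain P Q)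
  strips []               = []
  strips (_∷_ {C} chain chains) = strip {C} chain ++ strips chains

  strips-cover : ∀ {Cs} (chains : All (IsChain P) Cs) {u} → Any (u ∈_) Cs → ∀ x →
                 Any (_∈U_ P Q (u , x)) (strips chains)
  strips-cover (chain ∷ chains) (here u∈)  x = Any.++⁺ˡ (strip-cover chain u∈ x)
  strips-cover (_∷_ {C} chain chains) (there u∈) x = Any.++⁺ʳ (strip {C} chain) (strips-cover chains u∈ x)

  length-strips : ∀ {d} → IsDFun Q d → ∀ {Cs} (chains : All (IsChain P) Cs) →
                  length (strips chains) ≤ sumᴸ (map d (sizes Cs))
  length-strips isD []               = z≤n
  length-strips isD (_∷_ {C} chain chains) = ≤-trans (≤-reflexive (length-++ (strip {C} chain)))
    (+-mono-≤ (length-strip isD {C} chain) (length-strips isD chains))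

-- The min-max equality

theorem8 : (P Q : FinPoset) → DDecomposable P → CDecomposable P → DDecomposable Q →
    (hP hQ wP : ℕ) → IsHeight P hP → IsHeight Q hQ → IsWidth P wP →
    (dP cP dQ : ℕ → ℕ) → IsDFun P dP → IsCFun P cP → IsDFun Q dQ →
    MaxSemiantichain P Q (sum1to (hP ⊓ hQ) (λ i → diff dP i * diff dQ i))
    × MinUnichainCovering P Q (sum1to (hP ⊓ hQ) (λ i → diff dP i * diff dQ i))
    × sum1to (hP ⊓ hQ) (λ i → diff dP i * diff dQ i) ≡ sum1to wP (λ j → dQ (diff cP j))
theorem8 P Q (hP′ , hP′-max , As , lenA , antiA , disjA , _ , maxA)
             (wP′ , wP′-max , Cs , lenC , chainC , disjC , totalC , maxC)
             (hQ′ , hQ′-max , Bs , lenB , antiB , disjB , totalB , maxB)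
         hP hQ wP hP-max hQ-max wP-max dP cP dQ isDP isCP isDQ
  with MaxSize-unique hP′-max hP-max | MaxSize-unique hQ′-max hQ-max | MaxSize-unique wP′-max wP-max
... | refl | refl | refl =
  ( (S , semiS , lenS) , (λ T semiT → ≤-trans (weak-duality P Q semiT coverF) (≤-reflexive lenF))) ,
  ( (F , coverF , lenF) , (λ G coverG → subst (_≤ length G) lenS (weak-duality P Q semiS coverG))) ,
  value
  where
  open FinPoset Q using () renaming (size to nQ)
  open ≡-Reasoning

  μμ : ℕ
  μμ = sum1to (hP ⊓ hQ) (λ i → diff dP i * diff dQ i)

  partialA : PartialSums 0 dP (sizes As)
  partialA k k≤ = trans (MaxSize-unique (isDP k) (maxA k
    (subst (k ≤_) (trans (length-map ∣_∣ As) lenA) k≤))) (∣⋃-take∣ disjA k)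

  partialB : PartialSums 0 dQ (sizes Bs)
  partialB k k≤ = trans (MaxSize-unique (isDQ k) (maxB k
    (subst (k ≤_) (trans (length-map ∣_∣ Bs) lenB) k≤))) (∣⋃-take∣ disjB k)

  partialC : ∀ k → k ≤ length Cs → cP k ≡ sumᴸ (take k (sizes Cs))
  partialC k k≤ = trans (MaxSize-unique (isCP k) (maxC k (subst (k ≤_) lenC k≤))) (∣⋃-take∣ disjC k)

  greeneP : ∀ k → dP k ≡ sumᴸ (map (_⊓ k) (sizes Cs))
  greeneP = greene P chainC disjC totalC isDP isCP partialC

  sizesC≤hP : ∀ {Ds} → All (IsChain P) Ds → All (_≤ hP) (sizes Ds)
  sizesC≤hP []               = []
  sizesC≤hP (_∷_ {D} chain chains) = proj₂ hP-max D chain ∷ sizesC≤hP chains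

  dQ-hQ : dQ hQ ≡ nQ
  dQ-hQ = begin
    dQ hQ                ≡⟨ MaxSize-unique (isDQ hQ) (maxB hQ ≤-refl) ⟩
    ∣ ⋃ (take hQ Bs) ∣   ≡⟨ cong (λ Xs → ∣ ⋃ Xs ∣) (take-all hQ Bs (≤-reflexive lenB)) ⟩
    ∣ ⋃ Bs ∣             ≡⟨ cong ∣_∣ totalB ⟩
    ∣ ⊤ {nQ} ∣           ≡⟨ ∣⊤∣≡n nQ ⟩
    nQ                   ∎

  -- The antichains `Bs` exhaust Q, so `dQ` has reached its ceiling `nQ` at `hQ` and is constant
  -- from there on.
  μQ-vanishes : ∀ i → hQ ≤ i → diff dQ (suc i) ≡ 0
  μQ-vanishes i hQ≤i = m≤n⇒m∸n≡0 (≤-trans (d≤size Q isDQ (suc i))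
    (subst (_≤ dQ i) dQ-hQ (d-mono Q isDQ hQ≤i)))

  conjugate : μμ ≡ sumᴸ (map dQ (sizes Cs))
  conjugate = begin
    sum1to (hP ⊓ hQ) (λ i → diff dP i * diff dQ i)
      ≡⟨ sum1to-⊓ hP hQ (λ i hQ≤i → trans (cong (diff dP (suc i) *_) (μQ-vanishes i hQ≤i)) (*-zeroʳ (diff dP (suc i)))) ⟨
    sum1to hP (λ i → diff dP i * diff dQ i)
      ≡⟨ sum1to-cong hP (λ i → cong (_* diff dQ (suc i))
           (trans (cong₂ _∸_ (greeneP (suc i)) (greeneP i)) (diff-Σmin (sizes Cs) i))) ⟩
    sum1to hP (λ i → sumᴸ (map (atLeast i) (sizes Cs)) * diff dQ i)
      ≡⟨ Σd-conjugate (d-zero Q isDQ) (d-step Q isDQ) hP (sizes Cs) (sizesC≤hP chainC) ⟨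
    sumᴸ (map dQ (sizes Cs)) ∎

  value : μμ ≡ sum1to wP (λ j → dQ (diff cP j))
  value = begin
    μμ                                                       ≡⟨ conjugate ⟩
    sumᴸ (map dQ (sizes Cs))
      ≡⟨ sum-of-diffs dQ {0} (sizes Cs) (λ k k≤ → partialC k (subst (k ≤_) (length-map ∣_∣ Cs) k≤)) ⟨
    sum1to (length (sizes Cs)) (λ j → dQ (diff cP j))
      ≡⟨ cong (λ l → sum1to l (λ j → dQ (diff cP j))) (trans (length-map ∣_∣ Cs) lenC) ⟩
    sum1to wP (λ j → dQ (diff cP j))                         ∎

  S = blocks As Bs

  semiS : IsSemiantichain P Q S
  semiS = blocks-semiantichain P Q disjA antiA disjB antiB

  lenS : length S ≡ μμ
  lenS = begin
    length S                                     ≡⟨ length-blocks As Bs ⟩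
    sumᴸ (zipWith _*_ (sizes As) (sizes Bs))     ≡⟨ sum-of-diff-products (sizes As) (sizes Bs) partialA partialB ⟨
    sum1to (length (sizes As) ⊓ length (sizes Bs)) (λ i → diff dP i * diff dQ i)
      ≡⟨ cong₂ (λ k l → sum1to (k ⊓ l) (λ i → diff dP i * diff dQ i))
           (trans (length-map ∣_∣ As) lenA) (trans (length-map ∣_∣ Bs) lenB) ⟩
    μμ                                           ∎

  F = strips P Q chainC

  coverF : IsUnichainCovering P Q F
  coverF (u , x) = strips-cover P Q chainC (∈-⋃⁻ Cs (subst (u ∈_) (sym totalC) ∈⊤)) x

  -- The construction bounds the covering only from above; the semiantichain `S` supplies the lower
  -- bound.
  lenF : length F ≡ μμ
  lenF = ≤-antisym (≤-trans (length-strips P Q isDQ chainC) (≤-reflexive (sym conjugate)))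
           (subst (_≤ length F) lenS (weak-duality P Q semiS coverF))
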